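{- Let $p,n$ be positive integers with $p\ge n-1\ge 4$, and write $p=k(n-1)+r$ with $k$ a positive integer and $r\in\{0,1,\ldots,n-2\}$. Then $$ex(p;T_n^1)=\max\Big\{\Big[\tfrac{(n-2)p}2\Big]-(n-1+r),\ \tfrac{(n-2)p-r(n-1-r)}2\Big\},$$ and explicitly $$ex(p;T_n^1)=\begin{cases}[\frac{(n-2)p}2]-(n-1+r) & \text{if } n\ge 16 \text{ and } 3\le r\le n-6,\ \text{or if } 13\le n\le 15 \text{ and } 4\le r\le n-7,\\ \frac{(n-2)p-r(n-1-r)}2 & \text{otherwise.}\end{cases}$$
   Context: All graphs are finite and simple. For a graph $L$ and a positive integer $p$, $ex(p;L)$ denotes the maximum number of edges of a graph on $p$ vertices that contains no subgraph isomorphic to $L$. $[x]$ denotes the greatest integer not exceeding $x$. For $n\ge 5$, $T_n^1$ is the tree with vertex set $\{v_0,v_1,\ldots,v_{n-1}\}$ and edge set $\{v_0v_1,v_0v_2,\ldots,v_0v_{n-3},\ v_{n-4}v_{n-2},\ v_{n-3}v_{n-1}\}$. -}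

module Defs where

open import Data.Nat using (ℕ; zero; suc; _+_; _*_; _∸_; _≤_; _<_; _<ᵇ_; _⊔_; ⌊_/2⌋)
open import Data.Bool using (Bool; true; false; _∧_; if_then_else_)
open import Data.Fin using (Fin; toℕ)
open import Data.List using (List; map; allFin)
open import Data.Nat.ListAction using (sum)
open import Data.Product using (Σ; _×_; Σ-syntax)
open import Relation.Nullary using (¬_)
open import Relation.Binary.PropositionalEquality using (_≡_)
open import Function.Definitions using (Injective)

record Graph (p : ℕ) : Set where
  field
    adj    : Fin p → Fin p → Bool
    sym    : ∀ i j → adj i j ≡ adj j i
    irrefl : ∀ i → adj i i ≡ false
open Graph public

edges : ∀ {p} → Graph p → ℕ
edges {p} G =
  sum (map (λ i → sum (map (λ j → if (toℕ i <ᵇ toℕ j) ∧ adj G i j then 1 else 0)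
                           (allFin p)))
           (allFin p))

Contains : ∀ {p n} → Graph p → (Fin n → Fin n → Set) → Set
Contains {p} {n} G E =
  Σ[ f ∈ (Fin n → Fin p) ] (Injective _≡_ _≡_ f × (∀ u v → E u v → adj G (f u) (f v) ≡ true))

IsEx : ∀ {n} (p : ℕ) → (Fin n → Fin n → Set) → ℕ → Set
IsEx p E m =
  (Σ[ G ∈ Graph p ] (¬ Contains G E × edges G ≡ m))
  × (∀ (G : Graph p) → ¬ Contains G E → edges G ≤ m)

data T1Edgeℕ (n : ℕ) : ℕ → ℕ → Set where
  centre : ∀ {b} → 1 ≤ b → b ≤ n ∸ 3 → T1Edgeℕ n 0 b
  leftE  : T1Edgeℕ n (n ∸ 4) (n ∸ 2)
  rightE : T1Edgeℕ n (n ∸ 3) (n ∸ 1)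

T1 : (n : ℕ) → Fin n → Fin n → Set
T1 n u v = T1Edgeℕ n (toℕ u) (toℕ v)

exA : ℕ → ℕ → ℕ → ℕ
exA n p r = ⌊ (n ∸ 2) * p /2⌋ ∸ (n ∸ 1 + r)

exB : ℕ → ℕ → ℕ → ℕ
exB n p r = ⌊ ((n ∸ 2) * p ∸ r * (n ∸ 1 ∸ r)) /2⌋

CaseA : ℕ → ℕ → Set
CaseA n r = (16 ≤ n × 3 ≤ r × r ≤ n ∸ 6) Data.Sum.⊎ (13 ≤ n × n ≤ 15 × 4 ≤ r × r ≤ n ∸ 7)
  where import Data.Sum

{-# OPTIONS --safe #-}
-- Put N = n − 1.  A graph with maximum degree at most N − 3 has no T_n^1, while disjoint copies of K_N
-- and one K_r have none because their components are too small.  For the upper bound, measure a graph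
-- with e edges on p vertices by its deficit (N − 1) p − 2 e.  If all degrees are at most N − 3 the deficit
-- is at least 2 p.  Otherwise a vertex v of degree at least N − 2 exists, and since v is not the centre
-- of a T_n^1, the edges that leave its neighbourhood (or, when the degree is at least N, all edges not at v
-- that touch it) cannot contain two disjoint ones.  This yields s ≤ N vertices that meet at most s (s − 1) / 2
-- edges; deleting them costs no more than splitting off a K_s, so induction applies.
module Submission where

open import Defs hiding (sym)
open import Data.Nat using (ℕ; zero; suc; _+_; _*_; _∸_; _≤_; _<_; _<ᵇ_; _⊔_; ⌊_/2⌋; ⌈_/2⌉; ∣_-_∣; z≤n; s≤s; NonZero; _≤?_; _<?_)
import Data.Nat as ℕ
open import Data.Nat.DivMod using (_%_; [m+kn]%n≡m%n; m<n⇒m%n≡m; _/_; m≡m%n+[m/n]*n; m%n<n; m≥n⇒m/n>0; n%n≡0)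
open import Data.Nat.ListAction using (sum)
open import Data.Nat.ListAction.Properties using (sum-↭)
open import Data.Nat.Properties hiding (_≟_)
open import Data.Nat.Tactic.RingSolver using (solve-∀)
open import Data.Bool using (Bool; true; false; _∧_; _∨_; not; if_then_else_)
import Data.Bool as Bool
open import Data.Bool.Properties using (∨-comm; ∧-zeroʳ; T-≡; ∨-zeroʳ; ∧-identityʳ; ¬-not)
open import Data.Empty using (⊥; ⊥-elim)
open import Data.Fin using (Fin; toℕ; zero; suc; splitAt; _↑ˡ_; _↑ʳ_; inject₁; fromℕ<)
import Data.Fin.Properties as Finₚ
open import Data.Fin.Properties using (_≟_; toℕ<n; toℕ-injective; splitAt-↑ˡ; splitAt-↑ʳ; splitAt⁻¹-↑ˡ; splitAt⁻¹-↑ʳ; toℕ-inject₁; inject₁-injective; toℕ-fromℕ<; injective⇒≤)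
open import Data.List using (List; []; _∷_; _++_; map; length; filter; take; allFin; tabulate)
open import Data.List.Membership.Propositional using (_∈_; _∉_; find; lose)
open import Data.List.Membership.Propositional.Properties using (∈-++⁻; ∈-filter⁺; ∈-filter⁻; ∈-allFin; ∈-tabulate⁻)
open import Data.List.Properties using (filter-all; filter-notAll; length-++; length-take; ++-assoc; map-tabulate; length-tabulate)
open import Data.List.Relation.Binary.Permutation.Propositional using (_↭_; ↭-refl)
open import Data.List.Relation.Binary.Permutation.Propositional.Properties using (map⁺; ↭-length)
open import Data.List.Relation.Unary.All as All using ([]; _∷_)
open import Data.List.Relation.Unary.AllPairs using (AllPairs; []; _∷_)
import Data.List.Relation.Unary.AllPairs.Properties as AllPairsₚ
open import Data.List.Relation.Unary.Any using (here; there; any?)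
open import Data.List.Relation.Unary.Unique.Propositional using (Unique)
import Data.List.Relation.Unary.Unique.Propositional.Properties as Uniqueₚ
open import Data.Product using (_×_; _,_; proj₁; proj₂; Σ-syntax; ∃-syntax)
open import Data.Sum using (_⊎_; inj₁; inj₂; [_,_]′)
import Data.Sum as Sum
open import Function using (_∘_; id; Equivalence)
open import Relation.Binary.Definitions using (DecidableEquality)
open import Relation.Binary.PropositionalEquality using (_≡_; _≢_; refl; sym; trans; cong; cong₂; subst; subst₂; module ≡-Reasoning)
open import Relation.Nullary using (¬_; Dec; yes; no; contradiction; ¬?; does)
open import Relation.Nullary.Decidable using (_×-dec_; _⊎-dec_; dec-true)
open import Relation.Unary using (Decidable)

-- The deficit is additive over components, and a component K_s with s ≤ N has deficit s (N - s).
-- Merging K_r and K_s into one clique, or into K_N and a smaller remainder, lowers the total, so s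
-- (N - s) plus a permitted deficit for p - s vertices is again permitted for p: this is why the
-- induction closes. The alternative 2 (N + r) arises when K_N and K_r are traded for one graph on N
-- + r vertices of degree N - 3, each of which contributes 2. The induction runs over lists of
-- vertices of one fixed graph, so freeness from the tree never has to be carried to a subgraph.
-- Pairwise meeting edges form a star or a triangle, and this leads to cheap sets of 3 or 5
-- vertices. Five vertices exceed N when n = 5; there the tree is the path on five vertices, and
-- separate arguments give sets of 3 or 4. Throughout, l = n - 5 is the number of leaves adjacent to
-- the centre of the tree, so that N = 4 + l. All estimates concern doubled edge numbers; floors
-- enter only at the end.

interchange : ∀ a b c d → a + b + (c + d) ≡ a + c + (b + d)
interchange = solve-∀

bit : Bool → ℕ
bit b = if b then 1 else 0

bit≤1 : ∀ b → bit b ≤ 1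
bit≤1 true  = ≤-refl
bit≤1 false = z≤n

-- Counting edges inside a list of vertices

module _ {V : Set} where

  count : (V → Bool) → List V → ℕ
  count P xs = sum (map (λ x → if P x then 1 else 0) xs)

  count-↭ : ∀ P {xs ys} → xs ↭ ys → count P xs ≡ count P ys
  count-↭ P = sum-↭ ∘ map⁺ _

  count-filter : ∀ P xs → count P xs ≡ length (filter (λ x → P x Bool.≟ true) xs)
  count-filter P []       = refl
  count-filter P (x ∷ xs) with P x
  ... | true  = cong suc (count-filter P xs)
  ... | false = count-filter P xs

  -- A list of vertices stands for an induced subgraph, so no subgraph is ever reindexed. Each pair
  -- is counted at its earlier entry; for symmetric A the order of the list is immaterial.
  edgesIn : (V → V → Bool) → List V → ℕ
  edgesIn A []       = 0
  edgesIn A (x ∷ xs) = count (A x) xs + edgesIn A xs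

  edgesIn-↭ : ∀ {A} → (∀ x y → A x y ≡ A y x) → ∀ {xs ys} → xs ↭ ys → edgesIn A xs ≡ edgesIn A ys
  edgesIn-↭ A-sym _↭_.refl = refl
  edgesIn-↭ {A} A-sym (_↭_.prep x p) = cong₂ _+_ (count-↭ (A x) p) (edgesIn-↭ A-sym p)
  edgesIn-↭ {A} A-sym {x ∷ y ∷ xs} {y ∷ x ∷ ys} (_↭_.swap x y p)
    rewrite A-sym x y | count-↭ (A x) p | count-↭ (A y) p | edgesIn-↭ {A} A-sym p =
    interchange (bit (A y x)) (count (A x) ys) (count (A y) ys) (edgesIn A ys)
  edgesIn-↭ A-sym (_↭_.trans p q) = trans (edgesIn-↭ A-sym p) (edgesIn-↭ A-sym q)

  sumOver : (V → ℕ) → List V → ℕ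
  sumOver f xs = sum (map f xs)

  sumOver-+ : ∀ f g xs → sumOver (λ x → f x + g x) xs ≡ sumOver f xs + sumOver g xs
  sumOver-+ f g []       = refl
  sumOver-+ f g (x ∷ xs) rewrite sumOver-+ f g xs = interchange (f x) (g x) (sumOver f xs) (sumOver g xs)

  sumOver-cong : ∀ {f g} xs → (∀ {x} → x ∈ xs → f x ≡ g x) → sumOver f xs ≡ sumOver g xs
  sumOver-cong []       f≡g = refl
  sumOver-cong (x ∷ xs) f≡g = cong₂ _+_ (f≡g (here refl)) (sumOver-cong xs (f≡g ∘ there))

  sumOver-mono : ∀ {f g} xs → (∀ {x} → x ∈ xs → f x ≤ g x) → sumOver f xs ≤ sumOver g xs
  sumOver-mono []       f≤g = z≤n
  sumOver-mono (x ∷ xs) f≤g = +-mono-≤ (f≤g (here refl)) (sumOver-mono xs (f≤g ∘ there))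

  sumOver-const : ∀ c xs → sumOver (λ _ → c) xs ≡ length xs * c
  sumOver-const c []       = refl
  sumOver-const c (x ∷ xs) = cong (c +_) (sumOver-const c xs)

  -- A new vertex x raises the sum twice by its number of neighbours: through its own degree, and,
  -- by symmetry, through theirs.
  handshake : ∀ {A} → (∀ x y → A x y ≡ A y x) → (∀ x → A x x ≡ false) →
    ∀ xs → sumOver (λ x → count (A x) xs) xs ≡ 2 * edgesIn A xs
  handshake A-sym A-irr [] = refl
  handshake {A} A-sym A-irr (x ∷ xs) rewrite A-irr x = begin
    count (A x) xs + sumOver (λ y → bit (A y x) + count (A y) xs) xs
      ≡⟨ cong (count (A x) xs +_) (sumOver-+ (λ y → bit (A y x)) (λ y → count (A y) xs) xs) ⟩
    count (A x) xs + (sumOver (λ y → bit (A y x)) xs + sumOver (λ y → count (A y) xs) xs)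
      ≡⟨ cong₂ (λ s t → count (A x) xs + (s + t))
           (sumOver-cong xs (λ {y} _ → cong bit (A-sym y x))) (handshake A-sym A-irr xs) ⟩
    count (A x) xs + (count (A x) xs + 2 * edgesIn A xs)
      ≡⟨ double (count (A x) xs) (edgesIn A xs) ⟩
    2 * (count (A x) xs + edgesIn A xs) ∎
    where
    open ≡-Reasoning
    double : ∀ a b → a + (a + 2 * b) ≡ 2 * (a + b)
    double = solve-∀

-- Removing a vertex from a list without repetitions

module Removal {V : Set} (_≟_ : DecidableEquality V) where

  open import Data.List.Membership.DecPropositional _≟_ using (_∈?_)

  infixl 6 _─_

  -- Opaque, so that the list U can be inferred from U ─ x.
  abstract

    _─_ : List V → V → List V
    U ─ x = filter (λ y → ¬? (y ≟ x)) U

    ∈-─⁺ : ∀ {U x y} → y ∈ U → y ≢ x → y ∈ U ─ x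
    ∈-─⁺ = ∈-filter⁺ (λ y → ¬? (y ≟ _))

    ∈-─⁻ : ∀ {U x y} → y ∈ U ─ x → y ∈ U × y ≢ x
    ∈-─⁻ = ∈-filter⁻ (λ y → ¬? (y ≟ _))

    Unique-─ : ∀ {U} x → Unique U → Unique (U ─ x)
    Unique-─ x = Uniqueₚ.filter⁺ (λ y → ¬? (y ≟ x))

    ─-∉ : ∀ {U x} → x ∉ U → U ─ x ≡ U
    ─-∉ x∉U = filter-all (λ y → ¬? (y ≟ _)) (All.tabulate (λ y∈U y≡x → x∉U (subst (_∈ _) y≡x y∈U)))

    ─-here : ∀ {U x} → x ∉ U → (x ∷ U) ─ x ≡ U
    ─-here {x = x} x∉U with x ≟ x
    ... | yes _  = ─-∉ x∉U
    ... | no x≢x = contradiction refl x≢x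

    ─-there : ∀ {U x y} → y ≢ x → (y ∷ U) ─ x ≡ y ∷ (U ─ x)
    ─-there {x = x} {y} y≢x with y ≟ x
    ... | yes y≡x = contradiction y≡x y≢x
    ... | no _    = refl

    length-─-< : ∀ {U x} → x ∈ U → length (U ─ x) < length U
    length-─-< x∈U = filter-notAll (λ y → ¬? (y ≟ _)) _ (lose x∈U (λ x≢x → x≢x refl))

  ↭-─ : ∀ {U x} → Unique U → x ∈ U → U ↭ x ∷ (U ─ x)
  ↭-─ {x ∷ U} uU (here refl) rewrite ─-here (Uniqueₚ.Unique[x∷xs]⇒x∉xs uU) = ↭-refl
  ↭-─ {y ∷ U} {x} uU@(_ ∷ uU′) (there x∈U)
    rewrite ─-there {U} {x} {y} (λ y≡x → Uniqueₚ.Unique[x∷xs]⇒x∉xs uU (subst (_∈ U) (sym y≡x) x∈U)) =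
    _↭_.trans (_↭_.prep y (↭-─ uU′ x∈U)) (_↭_.swap y x ↭-refl)

  length-─ : ∀ {U x} → Unique U → x ∈ U → length U ≡ suc (length (U ─ x))
  length-─ uU x∈U = ↭-length (↭-─ uU x∈U)

  length≤─ : ∀ {U} x → Unique U → length U ≤ suc (length (U ─ x))
  length≤─ {U} x uU with x ∈? U
  ... | yes x∈U = ≤-reflexive (length-─ uU x∈U)
  ... | no x∉U  = ≤-trans (≤-reflexive (cong length (sym (─-∉ x∉U)))) (n≤1+n _)

  ⊆⇒length≤ : ∀ {xs ys} → Unique xs → (∀ {y} → y ∈ xs → y ∈ ys) → length xs ≤ length ys
  ⊆⇒length≤ {[]}     _                xs⊆ys = z≤n
  ⊆⇒length≤ {x ∷ xs} {ys} uxs@(_ ∷ uxs′) xs⊆ys = ≤-<-trans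
    (⊆⇒length≤ uxs′ (λ y∈xs → ∈-─⁺ (xs⊆ys (there y∈xs))
      (λ y≡x → Uniqueₚ.Unique[x∷xs]⇒x∉xs uxs (subst (_∈ xs) y≡x y∈xs))))
    (length-─-< (xs⊆ys (here refl)))

  count≤length : ∀ {P U Z} → Unique U → (∀ {y} → y ∈ U → P y ≡ true → y ∈ Z) → count P U ≤ length Z
  count≤length {P} {U} uU P⊆Z = ≤-trans (≤-reflexive (count-filter P U))
    (⊆⇒length≤ (Uniqueₚ.filter⁺ _ uU)
      (λ y∈ → let y∈U , Py = ∈-filter⁻ (λ y → P y Bool.≟ true) y∈ in P⊆Z y∈U Py))

-- Arithmetic of deficits

-- The deficits permitted by the extremal graphs on p = kN + r vertices: r (N − r) for copies of K_N and a K_r,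
-- and 2 (N + r) when one component of size N + r has all degrees equal to N − 3.
record Deficit (N p d : ℕ) : Set where
  constructor deficit
  field
    k r r′ : ℕ
    r+r′≡N : r + r′ ≡ N
    p≡kN+r : p ≡ k * N + r
    bound  : r * r′ ≤ d ⊎ (1 ≤ k × 2 * (N + r) ≤ d)

-- If r + s ≤ N, the cliques K_r and K_s merge into K_(r+s), which saves 2 r s. Otherwise r′ of the
-- s vertices complete K_r to a further K_N, u = s - r′ remain, and 2 r′ s′ is saved.
Deficit-+ : ∀ {N p d s s′} → s + s′ ≡ N → Deficit N p d → Deficit N (s + p) (s * s′ + d)
Deficit-+ {N} {p} {d} {s} {s′} s+s′≡N (deficit k r r′ r+r′≡N refl b) with ≤-total s r′
... | inj₁ s≤r′ with m≤n⇒∃[o]m+o≡n s≤r′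
...   | u , refl = deficit k (r + s) u r+s+u≡N (shift s (k * N) r) (small b)
  where
  shift : ∀ s x r → s + (x + r) ≡ x + (r + s)
  shift = solve-∀
  r+s+u≡N : r + s + u ≡ N
  r+s+u≡N = trans (+-assoc r s u) r+r′≡N
  s′≡r+u : s′ ≡ r + u
  s′≡r+u = +-cancelˡ-≡ s _ _ (trans s+s′≡N (trans (sym r+s+u≡N) (rotate r s u)))
    where
    rotate : ∀ r s u → r + s + u ≡ s + (r + u)
    rotate = solve-∀
  small : r * (s + u) ≤ d ⊎ (1 ≤ k × 2 * (N + r) ≤ d) →
    (r + s) * u ≤ s * s′ + d ⊎ (1 ≤ k × 2 * (N + (r + s)) ≤ s * s′ + d)
  small (inj₁ b) rewrite s′≡r+u = inj₁ (begin
    (r + s) * u                     ≤⟨ m≤n+m _ (2 * (r * s)) ⟩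
    2 * (r * s) + (r + s) * u       ≡⟨ expand r s u ⟩
    s * (r + u) + r * (s + u)       ≤⟨ +-monoʳ-≤ (s * (r + u)) b ⟩
    s * (r + u) + d                 ∎)
    where
    open ≤-Reasoning
    expand : ∀ r s u → 2 * (r * s) + (r + s) * u ≡ s * (r + u) + r * (s + u)
    expand = solve-∀
  small (inj₂ (1≤k , b)) rewrite s′≡r+u = large r u b
    where
    open ≤-Reasoning
    expand : ∀ N r s → 2 * (N + (r + s)) ≡ s * 2 + 2 * (N + r)
    expand = solve-∀
    large : ∀ r u → 2 * (N + r) ≤ d →
      (r + s) * u ≤ s * (r + u) + d ⊎ (1 ≤ k × 2 * (N + (r + s)) ≤ s * (r + u) + d)
    -- The bound 2 (N + r) has to grow by 2 s, which s s′ = s (r + u) supplies as soon as r + u ≥ 2.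
    -- In the two cases with u = 0, or with r = 0 and u = 1, the product bound holds outright.
    large r zero b = inj₁ (≤-trans (≤-reflexive (*-zeroʳ (r + s))) z≤n)
    large zero (suc zero) b = inj₁ (m≤m+n (s * 1) d)
    large r@zero (suc (suc u)) b = inj₂ (1≤k , (begin
      2 * (N + (r + s))     ≡⟨ expand N r s ⟩
      s * 2 + 2 * (N + r)   ≤⟨ +-mono-≤ (*-monoʳ-≤ s (s≤s (s≤s z≤n))) b ⟩
      s * suc (suc u) + d   ∎))
    large r@(suc r-1) (suc u) b = inj₂ (1≤k , (begin
      2 * (N + (r + s))     ≡⟨ expand N r s ⟩
      s * 2 + 2 * (N + r)   ≤⟨ +-mono-≤ (*-monoʳ-≤ s (s≤s (≤-trans (s≤s z≤n) (m≤n+m (suc u) r-1)))) b ⟩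
      s * (r + suc u) + d   ∎))
Deficit-+ {N} {p} {d} {s} {s′} s+s′≡N (deficit k r r′ r+r′≡N refl b) | inj₂ r′≤s with m≤n⇒∃[o]m+o≡n r′≤s
... | u , refl = deficit (suc k) u (r′ + s′) (trans (swap u r′ s′) s+s′≡N)
    (trans (cong (λ r → r′ + u + (k * N + r)) r≡u+s′)
      (trans (carry r′ u (k * N) s′) (cong (λ M → M + k * N + u) s+s′≡N)))
    (wrap b)
  where
  open ≤-Reasoning
  swap : ∀ u r′ s′ → u + (r′ + s′) ≡ r′ + u + s′
  swap = solve-∀
  r≡u+s′ : r ≡ u + s′
  r≡u+s′ = +-cancelʳ-≡ r′ _ _ (trans r+r′≡N (trans (sym s+s′≡N) (rotate r′ u s′)))
    where
    rotate : ∀ r′ u s′ → r′ + u + s′ ≡ u + s′ + r′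
    rotate = solve-∀
  carry : ∀ r′ u x s′ → r′ + u + (x + (u + s′)) ≡ r′ + u + s′ + x + u
  carry = solve-∀
  wrap : r * r′ ≤ d ⊎ (1 ≤ k × 2 * (N + r) ≤ d) →
    u * (r′ + s′) ≤ (r′ + u) * s′ + d ⊎ (1 ≤ suc k × 2 * (N + u) ≤ (r′ + u) * s′ + d)
  wrap (inj₁ b) = inj₁ (begin
    u * (r′ + s′)                        ≤⟨ m≤n+m _ (2 * (r′ * s′)) ⟩
    2 * (r′ * s′) + u * (r′ + s′)        ≡⟨ expand r′ u s′ ⟩
    (r′ + u) * s′ + (u + s′) * r′        ≡⟨ cong (λ r → (r′ + u) * s′ + r * r′) (sym r≡u+s′) ⟩
    (r′ + u) * s′ + r * r′               ≤⟨ +-monoʳ-≤ ((r′ + u) * s′) b ⟩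
    (r′ + u) * s′ + d                    ∎)
    where
    expand : ∀ r′ u s′ → 2 * (r′ * s′) + u * (r′ + s′) ≡ (r′ + u) * s′ + (u + s′) * r′
    expand = solve-∀
  -- The new residue u = r - s′ is at most r, so the old bound is already strong enough.
  wrap (inj₂ (1≤k , b)) = inj₂ (s≤s z≤n , (begin
    2 * (N + u)          ≤⟨ *-monoʳ-≤ 2 (+-monoʳ-≤ N (≤-trans (m≤m+n u s′) (≤-reflexive (sym r≡u+s′)))) ⟩
    2 * (N + r)          ≤⟨ b ⟩
    d                    ≤⟨ m≤n+m d _ ⟩
    (r′ + u) * s′ + d    ∎))

Deficit-zero : ∀ N → Deficit N 0 0
Deficit-zero N = deficit 0 0 N refl refl (inj₁ z≤n)

-- With k ≥ 1 full blocks, p = k N + r is at least N + r.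
Deficit-sparse : ∀ N .{{_ : NonZero N}} {p} → N ≤ p → Deficit N p (2 * p)
Deficit-sparse N {p} N≤p with m≤n⇒∃[o]m+o≡n (<⇒≤ (m%n<n p N))
... | r′ , r+r′≡N = deficit (p / N) (p % N) r′ r+r′≡N p≡
    (inj₂ (m≥n⇒m/n>0 N≤p , *-monoʳ-≤ 2 (begin
      N + p % N             ≤⟨ +-monoˡ-≤ (p % N) (≤-trans (≤-reflexive (sym (*-identityˡ N))) (*-monoˡ-≤ N (m≥n⇒m/n>0 N≤p))) ⟩
      p / N * N + p % N     ≡⟨ sym p≡ ⟩
      p                     ∎)))
  where
  open ≤-Reasoning
  p≡ : p ≡ p / N * N + p % N
  p≡ = trans (m≡m%n+[m/n]*n p N) (+-comm (p % N) _)

-- A `Deficit` may record residue N in place of 0. Then N divides p, which forces r = 0, and the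
-- product r r′ vanishes. In all other cases both decompositions of p agree.
Deficit-unique : ∀ N .{{_ : NonZero N}} {d k r r′} → r < N → r + r′ ≡ N →
  Deficit N (k * N + r) d → r * r′ ≤ d ⊎ 2 * (N + r) ≤ d
Deficit-unique N {d} {k} {r} {r′} r<N r+r′≡N (deficit k₁ r₁ r₁′ r₁+r₁′≡N p≡ b)
  with m≤n⇒m<n∨m≡n (≤-trans (m≤m+n r₁ r₁′) (≤-reflexive r₁+r₁′≡N))
... | inj₁ r₁<N with trans (sym (residue k r<N)) (trans (cong (_% N) p≡) (residue k₁ r₁<N))
  where
  residue : ∀ k {r} → r < N → (k * N + r) % N ≡ r
  residue k {r} r<N = trans (cong (_% N) (+-comm (k * N) r)) (trans ([m+kn]%n≡m%n r k N) (m<n⇒m%n≡m r<N))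
...   | refl rewrite +-cancelˡ-≡ r r₁′ r′ (trans r₁+r₁′≡N (sym r+r′≡N)) = Sum.map id proj₂ b
Deficit-unique N {d} {k} {r} {r′} r<N r+r′≡N (deficit k₁ r₁ r₁′ r₁+r₁′≡N p≡ b) | inj₂ refl =
  inj₁ (≤-trans (≤-reflexive (cong (_* r′) r≡0)) z≤n)
  where
  r≡0 : r ≡ 0
  r≡0 = begin
    r                   ≡⟨ sym (m<n⇒m%n≡m r<N) ⟩
    r % N               ≡⟨ sym ([m+kn]%n≡m%n r k N) ⟩
    (r + k * N) % N     ≡⟨ cong (_% N) (trans (+-comm r (k * N)) p≡) ⟩
    (k₁ * N + N) % N    ≡⟨ cong (_% N) (+-comm (k₁ * N) N) ⟩
    (N + k₁ * N) % N    ≡⟨ [m+kn]%n≡m%n N k₁ N ⟩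
    N % N               ≡⟨ n%n≡0 N ⟩
    0                   ∎
    where open ≡-Reasoning

-- The induction step in numbers

triangular : ℕ → ℕ
triangular zero    = 0
triangular (suc n) = n + triangular n

2*triangular : ∀ n → 2 * triangular n + n ≡ n * n
2*triangular zero    = refl
2*triangular (suc n) = begin
  2 * (n + triangular n) + suc n         ≡⟨ regroup n (triangular n) ⟩
  2 * n + 1 + (2 * triangular n + n)     ≡⟨ cong (2 * n + 1 +_) (2*triangular n) ⟩
  2 * n + 1 + n * n                      ≡⟨ square n ⟩
  suc n * suc n                          ∎
  where
  open ≡-Reasoning
  regroup : ∀ n t → 2 * (n + t) + suc n ≡ 2 * n + 1 + (2 * t + n)
  regroup = solve-∀
  square : ∀ n → 2 * n + 1 + n * n ≡ suc n * suc n
  square = solve-∀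

-- Here N′ = N − 1, e is the number of edges and p the number of vertices.
EdgeBound : ℕ → ℕ → ℕ → Set
EdgeBound N′ e p = ∃[ d ] (Deficit (suc N′) p d × 2 * e + d ≤ N′ * p)

-- Since s (s - 1) + s (N - s) = s (N - 1), vertices that meet at most s (s - 1) / 2 edges add at
-- least s (N - s) to the deficit, as a separate K_s would.
EdgeBound-+ : ∀ {N′ e₀ e p s t} → s ≤ suc N′ → 2 * t + s ≤ s * s → e₀ ≤ t + e →
  EdgeBound N′ e p → EdgeBound N′ e₀ (s + p)
EdgeBound-+ {N′} {e₀} {e} {p} {s} {t} s≤N 2t+s≤s² e₀≤t+e (d , Dd , 2e+d≤) with m≤n⇒∃[o]m+o≡n s≤N
... | s′ , s+s′≡N = s * s′ + d , Deficit-+ s+s′≡N Dd , (begin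
  2 * e₀ + (s * s′ + d)                ≤⟨ +-monoˡ-≤ _ (*-monoʳ-≤ 2 e₀≤t+e) ⟩
  2 * (t + e) + (s * s′ + d)           ≡⟨ regroup t e (s * s′) d ⟩
  (2 * t + s * s′) + (2 * e + d)       ≤⟨ +-mono-≤ local 2e+d≤ ⟩
  N′ * s + N′ * p                      ≡⟨ sym (*-distribˡ-+ N′ s p) ⟩
  N′ * (s + p)                         ∎)
  where
  open ≤-Reasoning
  regroup : ∀ t e x d → 2 * (t + e) + (x + d) ≡ (2 * t + x) + (2 * e + d)
  regroup = solve-∀
  local : 2 * t + s * s′ ≤ N′ * s
  -- Adding s to both sides turns s (s - 1) into s * s and N - 1 into N, so nothing is subtracted.
  local = +-cancelˡ-≤ s _ _ (begin
    s + (2 * t + s * s′)       ≡⟨ shuffle s t (s * s′) ⟩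
    2 * t + s + s * s′         ≤⟨ +-monoˡ-≤ (s * s′) 2t+s≤s² ⟩
    s * s + s * s′             ≡⟨ sym (*-distribˡ-+ s s s′) ⟩
    s * (s + s′)               ≡⟨ cong (s *_) s+s′≡N ⟩
    s * suc N′                 ≡⟨ *-comm s (suc N′) ⟩
    s + N′ * s                 ∎)
    where
    shuffle : ∀ s t x → s + (2 * t + x) ≡ 2 * t + s + x
    shuffle = solve-∀

-- Edges lost when vertices are deleted one after another

module Deletion {V : Set} (_≟_ : DecidableEquality V) (A : V → V → Bool)
  (A-sym : ∀ x y → A x y ≡ A y x) (A-irr : ∀ x → A x x ≡ false) where

  open Removal _≟_ public

  degree : List V → V → ℕ
  degree U x = count (A x) U

  edgesIn-─ : ∀ {U x} → Unique U → x ∈ U → edgesIn A U ≡ degree U x + edgesIn A (U ─ x)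
  edgesIn-─ {U} {x} uU x∈U = trans (edgesIn-↭ A-sym (↭-─ uU x∈U))
    (cong (_+ edgesIn A (U ─ x))
      (sym (trans (count-↭ (A x) (↭-─ uU x∈U)) (cong (λ b → bit b + count (A x) (U ─ x)) (A-irr x)))))

  degree-─ : ∀ {U x} y → Unique U → x ∈ U → degree (U ─ x) y ≤ degree U y
  degree-─ y uU x∈U = ≤-trans (m≤n+m _ _) (≤-reflexive (sym (count-↭ (A y) (↭-─ uU x∈U))))

  infixl 6 _─*_

  _─*_ : List V → List V → List V
  U ─* []      = U
  U ─* (x ∷ S) = (U ─ x) ─* S

  _⊑_ : List V → List V → Set
  S ⊑ U = ∀ {y} → y ∈ S → y ∈ U

  ⊑-─ : ∀ {U x S} → Unique (x ∷ S) → (x ∷ S) ⊑ U → S ⊑ (U ─ x)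
  ⊑-─ uxS S⊑U y∈S = ∈-─⁺ (S⊑U (there y∈S)) (λ y≡x → Uniqueₚ.Unique[x∷xs]⇒x∉xs uxS (subst (_∈ _) y≡x y∈S))

  Unique-─* : ∀ {U} S → Unique U → Unique (U ─* S)
  Unique-─* []      uU = uU
  Unique-─* (x ∷ S) uU = Unique-─* S (Unique-─ x uU)

  length-─* : ∀ {U} S → Unique U → Unique S → S ⊑ U → length U ≡ length S + length (U ─* S)
  length-─* []      uU uS S⊑U = refl
  length-─* (x ∷ S) uU uS@(_ ∷ uS′) S⊑U = trans (length-─ uU (S⊑U (here refl)))
    (cong suc (length-─* S (Unique-─ x uU) uS′ (⊑-─ uS S⊑U)))

  -- For S inside U this says that at most t edges of U meet S. In this form the costs of successive
  -- deletions simply add up.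
  Cost : List V → List V → ℕ → Set
  Cost U S t = edgesIn A U ≤ t + edgesIn A (U ─* S)

  cost-∷ : ∀ {U x c t} S → Unique U → x ∈ U → degree U x ≤ c → Cost (U ─ x) S t → Cost U (x ∷ S) (c + t)
  cost-∷ {U} {x} {c} {t} S uU x∈U deg≤c cost = begin
    edgesIn A U                              ≡⟨ edgesIn-─ uU x∈U ⟩
    degree U x + edgesIn A (U ─ x)           ≤⟨ +-mono-≤ deg≤c cost ⟩
    c + (t + edgesIn A (U ─ x ─* S))         ≡⟨ sym (+-assoc c t _) ⟩
    c + t + edgesIn A (U ─ x ─* S)           ∎
    where open ≤-Reasoning

  cost-degrees : ∀ {U q} S → Unique U → Unique S → S ⊑ U →
    (∀ {x} → x ∈ S → degree U x ≤ q) → Cost U S (length S * q)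
  cost-degrees []      uU uS S⊑U deg≤q = ≤-refl
  cost-degrees (x ∷ S) uU uS@(_ ∷ uS′) S⊑U deg≤q =
    cost-∷ S uU (S⊑U (here refl)) (deg≤q (here refl))
      (cost-degrees S (Unique-─ x uU) uS′ (⊑-─ uS S⊑U)
        (λ {y} y∈S → ≤-trans (degree-─ y uU (S⊑U (here refl))) (deg≤q (there y∈S))))

  -- When the vertices of S are deleted in order, each has neighbours only among the later ones, and
  -- the rest of S stays closed in the rest of U.
  cost-closed : ∀ {U} S → Unique U → Unique S → S ⊑ U →
    (∀ {x y} → x ∈ S → y ∈ U → A x y ≡ true → y ∈ S) → Cost U S (triangular (length S))
  cost-closed []      uU uS S⊑U closed = ≤-refl
  cost-closed {U} (x ∷ S) uU uS@(_ ∷ uS′) S⊑U closed =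
    cost-∷ S uU (S⊑U (here refl))
      (count≤length uU (λ y∈U Axy → tail Axy (closed (here refl) y∈U Axy)))
      (cost-closed S (Unique-─ x uU) uS′ (⊑-─ uS S⊑U) closed′)
    where
    tail : ∀ {y} → A x y ≡ true → y ∈ (x ∷ S) → y ∈ S
    tail Axx (here refl) with () ← trans (sym Axx) (A-irr x)
    tail _   (there y∈S) = y∈S
    closed′ : ∀ {z y} → z ∈ S → y ∈ U ─ x → A z y ≡ true → y ∈ S
    closed′ z∈S y∈ Azy with ∈-─⁻ y∈
    ... | y∈U , y≢x with closed (there z∈S) y∈U Azy
    ...   | here y≡x  = contradiction y≡x y≢x
    ...   | there y∈S = y∈S

-- Embedding the tree

module _ {V : Set} where

  nth : V → List V → ℕ → V
  nth d []       _       = d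
  nth d (x ∷ xs) zero    = x
  nth d (x ∷ xs) (suc i) = nth d xs i

  nth-∈ : ∀ {d} xs {i} → i < length xs → nth d xs i ∈ xs
  nth-∈ (x ∷ xs) {zero}  _         = here refl
  nth-∈ (x ∷ xs) {suc i} (s≤s i<) = there (nth-∈ xs i<)

  nth-++ˡ : ∀ {d} xs ys {i} → i < length xs → nth d (xs ++ ys) i ≡ nth d xs i
  nth-++ˡ (x ∷ xs) ys {zero}  _         = refl
  nth-++ˡ (x ∷ xs) ys {suc i} (s≤s i<) = nth-++ˡ xs ys i<

  nth-++ʳ : ∀ {d} xs ys j → nth d (xs ++ ys) (j + length xs) ≡ nth d ys j
  nth-++ʳ []       ys j = cong (nth _ ys) (+-identityʳ j)
  nth-++ʳ {d} (x ∷ xs) ys j = trans (cong (nth d (x ∷ xs ++ ys)) (+-suc j (length xs))) (nth-++ʳ xs ys j)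

  nth-injective : ∀ {d} xs → Unique xs → ∀ {i j} → i < length xs → j < length xs →
    nth d xs i ≡ nth d xs j → i ≡ j
  nth-injective (x ∷ xs) _ {zero} {zero} _ _ _ = refl
  nth-injective (x ∷ xs) uxs {zero} {suc j} _ (s≤s j<) eq =
    contradiction (subst (_∈ xs) (sym eq) (nth-∈ xs j<)) (Uniqueₚ.Unique[x∷xs]⇒x∉xs uxs)
  nth-injective (x ∷ xs) uxs {suc i} {zero} (s≤s i<) _ eq =
    contradiction (subst (_∈ xs) eq (nth-∈ xs i<)) (Uniqueₚ.Unique[x∷xs]⇒x∉xs uxs)
  nth-injective (x ∷ xs) (_ ∷ uxs) {suc i} {suc j} (s≤s i<) (s≤s j<) eq =
    cong suc (nth-injective xs uxs i< j< eq)

take-⊆ : ∀ {V : Set} n xs {y : V} → y ∈ take n xs → y ∈ xs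
take-⊆ (suc n) (x ∷ xs) (here refl) = here refl
take-⊆ (suc n) (x ∷ xs) (there y∈) = there (take-⊆ n xs y∈)

adj⇒≢ : ∀ {p} (G : Graph p) {x y} → adj G x y ≡ true → x ≢ y
adj⇒≢ G {x} Axx refl with () ← trans (sym Axx) (irrefl G x)

module _ {p} (G : Graph p) where

  -- In the list `ws` position i holds the image of v_i: the centre at 0, its l leaves at 1 to l,
  -- then a₁ and a₂ at n - 4 and n - 3, and their outer neighbours b₁ and b₂ at n - 2 and n - 1.
  spider : ∀ {l} (v a₁ a₂ b₁ b₂ : Fin p) (L : List (Fin p)) → length L ≡ l →
    Unique (v ∷ L ++ a₁ ∷ a₂ ∷ b₁ ∷ b₂ ∷ []) →
    (∀ {y} → y ∈ L ++ a₁ ∷ a₂ ∷ [] → adj G v y ≡ true) →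
    adj G a₁ b₁ ≡ true → adj G a₂ b₂ ≡ true → Contains G (T1 (5 + l))
  spider v a₁ a₂ b₁ b₂ L refl uws vL a₁b₁ a₂b₂ =
    (λ i → g (toℕ i)) ,
    (λ {i} {j} eq → toℕ-injective (nth-injective ws uws (bounded i) (bounded j) eq)) ,
    (λ _ _ → edge)
    where
    feet ws : List (Fin p)
    feet = a₁ ∷ a₂ ∷ b₁ ∷ b₂ ∷ []
    ws   = v ∷ L ++ feet
    g : ℕ → Fin p
    g = nth v ws
    bounded : ∀ i → toℕ {5 + length L} i < length ws
    bounded i = <-≤-trans (toℕ<n i) (≤-reflexive (cong suc (trans (+-comm 4 (length L)) (sym (length-++ L)))))
    edge : ∀ {i j} → T1Edgeℕ (5 + length L) i j → adj G (g i) (g j) ≡ true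
    edge (centre {suc i} _ (s≤s i≤)) = vL (subst (_∈ L ++ a₁ ∷ a₂ ∷ []) (sym here-eq) (nth-∈ (L ++ a₁ ∷ a₂ ∷ []) i<))
      where
      i< : i < length (L ++ a₁ ∷ a₂ ∷ [])
      i< = ≤-trans (s≤s i≤) (≤-reflexive (trans (+-comm 2 (length L)) (sym (length-++ L))))
      here-eq : g (suc i) ≡ nth v (L ++ a₁ ∷ a₂ ∷ []) i
      here-eq = trans (cong (λ xs → nth v xs i) (sym (++-assoc L (a₁ ∷ a₂ ∷ []) (b₁ ∷ b₂ ∷ []))))
                      (nth-++ˡ (L ++ a₁ ∷ a₂ ∷ []) (b₁ ∷ b₂ ∷ []) i<)
    edge leftE  rewrite nth-++ʳ {d = v} L feet 0 | nth-++ʳ {d = v} L feet 2 = a₁b₁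
    edge rightE rewrite nth-++ʳ {d = v} L feet 1 | nth-++ʳ {d = v} L feet 3 = a₂b₂

  open Removal (_≟_ {p})

  -- The l leaves at the centre are taken from what is left of Γ, a list of neighbours of v, after
  -- the other four vertices are struck out.
  neighbourhood-spider : ∀ {l v a₁ a₂ b₁ b₂} →
    adj G v a₁ ≡ true → adj G v a₂ ≡ true → adj G a₁ b₁ ≡ true → adj G a₂ b₂ ≡ true →
    a₁ ≢ a₂ → a₁ ≢ b₂ → a₂ ≢ b₁ → b₁ ≢ b₂ → b₁ ≢ v → b₂ ≢ v →
    ∀ {Γ} → Unique Γ → (∀ {y} → y ∈ Γ → adj G v y ≡ true) →
    l ≤ length (Γ ─ a₁ ─ a₂ ─ b₁ ─ b₂) → Contains G (T1 (5 + l))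
  neighbourhood-spider {l} {v} {a₁} {a₂} {b₁} {b₂} va₁ va₂ a₁b₁ a₂b₂ a₁≢a₂ a₁≢b₂ a₂≢b₁ b₁≢b₂ b₁≢v b₂≢v {Γ} uΓ vΓ l≤ =
    spider v a₁ a₂ b₁ b₂ L (trans (length-take l rest) (m≤n⇒m⊓n≡m l≤)) uws vL a₁b₁ a₂b₂
    where
    rest L : List (Fin p)
    rest = Γ ─ a₁ ─ a₂ ─ b₁ ─ b₂
    L = take l rest
    avoids : ∀ {y} → y ∈ L → y ∈ Γ × y ≢ a₁ × y ≢ a₂ × y ≢ b₁ × y ≢ b₂
    avoids y∈L with ∈-─⁻ (take-⊆ l rest y∈L)
    ... | y∈₃ , y≢b₂ with ∈-─⁻ y∈₃
    ...   | y∈₂ , y≢b₁ with ∈-─⁻ y∈₂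
    ...     | y∈₁ , y≢a₂ with ∈-─⁻ y∈₁
    ...       | y∈Γ , y≢a₁ = y∈Γ , y≢a₁ , y≢a₂ , y≢b₁ , y≢b₂
    vL : ∀ {y} → y ∈ L ++ a₁ ∷ a₂ ∷ [] → adj G v y ≡ true
    vL y∈ with ∈-++⁻ L y∈
    ... | inj₁ y∈L                 = vΓ (proj₁ (avoids y∈L))
    ... | inj₂ (here refl)         = va₁
    ... | inj₂ (there (here refl)) = va₂
    v∉ : ∀ {y} → y ∈ L ++ a₁ ∷ a₂ ∷ b₁ ∷ b₂ ∷ [] → v ≢ y
    v∉ y∈ with ∈-++⁻ L y∈
    ... | inj₁ y∈L                                 = adj⇒≢ G (vΓ (proj₁ (avoids y∈L)))
    ... | inj₂ (here refl)                         = adj⇒≢ G va₁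
    ... | inj₂ (there (here refl))                 = adj⇒≢ G va₂
    ... | inj₂ (there (there (here refl)))         = b₁≢v ∘ sym
    ... | inj₂ (there (there (there (here refl)))) = b₂≢v ∘ sym
    disjoint : ∀ {y} → ¬ (y ∈ L × y ∈ a₁ ∷ a₂ ∷ b₁ ∷ b₂ ∷ [])
    disjoint (y∈L , y∈feet) with avoids y∈L | y∈feet
    ... | _ , y≢a₁ , y≢a₂ , y≢b₁ , y≢b₂ | here refl                         = y≢a₁ refl
    ... | _ , y≢a₁ , y≢a₂ , y≢b₁ , y≢b₂ | there (here refl)                 = y≢a₂ refl
    ... | _ , y≢a₁ , y≢a₂ , y≢b₁ , y≢b₂ | there (there (here refl))         = y≢b₁ refl
    ... | _ , y≢a₁ , y≢a₂ , y≢b₁ , y≢b₂ | there (there (there (here refl))) = y≢b₂ refl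
    uws : Unique (v ∷ L ++ a₁ ∷ a₂ ∷ b₁ ∷ b₂ ∷ [])
    uws = All.tabulate v∉ ∷ Uniqueₚ.++⁺
      (Uniqueₚ.take⁺ l (Unique-─ b₂ (Unique-─ b₁ (Unique-─ a₂ (Unique-─ a₁ uΓ)))))
      ((a₁≢a₂ ∷ adj⇒≢ G a₁b₁ ∷ a₁≢b₂ ∷ []) ∷ (a₂≢b₁ ∷ adj⇒≢ G a₂b₂ ∷ []) ∷ (b₁≢b₂ ∷ []) ∷ [] ∷ [])
      disjoint

-- The upper bound

search : ∀ {V : Set} {P : V → Set} → Decidable P → ∀ xs →
  (∃[ x ] (x ∈ xs × P x)) ⊎ (∀ {x} → x ∈ xs → ¬ P x)
search P? xs with any? P? xs
... | yes any = inj₁ (find any)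
... | no ¬any = inj₂ (λ x∈xs Px → ¬any (lose x∈xs Px))

module UpperBound {p} (l : ℕ) (G : Graph p) (T-free : ¬ Contains G (T1 (5 + l))) where

  open Deletion (_≟_ {p}) (adj G) (Graph.sym G) (irrefl G)
  open import Data.List.Membership.DecPropositional (_≟_ {p}) using (_∈?_)

  V : Set
  V = Fin p

  infix 4 _~_
  _~_ : V → V → Set
  x ~ y = adj G x y ≡ true

  _~?_ : ∀ x y → _
  x ~? y = adj G x y Bool.≟ true

  ~-sym : ∀ {x y} → x ~ y → y ~ x
  ~-sym {x} {y} x~y = trans (Graph.sym G y x) x~y

  ~⇒≢ : ∀ {x y} → x ~ y → x ≢ y
  ~⇒≢ = adj⇒≢ G

  Bounded : List V → Set
  Bounded U = EdgeBound (3 + l) (edgesIn (adj G) U) (length U)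

  -- For n = 5 the tree is the path z, v, x, c, y with centre x. It has no leaf at the centre, so
  -- the empty list serves as Γ.
  P₅-free : l ≡ 0 → ∀ {z v x c y} → z ~ v → v ~ x → x ~ c → c ~ y →
    v ≢ c → v ≢ y → c ≢ z → z ≢ y → z ≢ x → y ≢ x → ⊥
  P₅-free l≡0 z~v v~x x~c c~y v≢c v≢y c≢z z≢y z≢x y≢x =
    subst (λ l → ¬ Contains G (T1 (5 + l))) l≡0 T-free
      (neighbourhood-spider G (~-sym v~x) x~c (~-sym z~v) c~y v≢c v≢y c≢z z≢y z≢x y≢x {[]} [] (λ ()) z≤n)

  -- Cheap sets of vertices for the induction step

  module Step (U : List V) (uU : Unique U)
              (rec : ∀ R → Unique R → length R < length U → Bounded R) where

    -- The only place where the induction hypothesis is applied; the cases below supply suitable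
    -- sets S. As S is not empty, the remaining list is shorter.
    delete : ∀ S {t} → Unique S → S ⊑ U → 1 ≤ length S → length S ≤ 4 + l →
      Cost U S t → 2 * t + length S ≤ length S * length S → Bounded U
    delete S {t} uS S⊑U 1≤s s≤N cost cheap =
      subst (EdgeBound (3 + l) (edgesIn (adj G) U)) (sym len)
        (EdgeBound-+ {e = edgesIn (adj G) (U ─* S)} {t = t} s≤N cheap cost
          (rec (U ─* S) (Unique-─* S uU) (≤-trans (+-monoˡ-≤ _ 1≤s) (≤-reflexive (sym len)))))
      where len = length-─* S uU uS S⊑U

    -- The numerical condition amounts to 2 q + 1 ≤ s. It is used with three vertices of degree at
    -- most 1 and with five of degree at most 2.
    delete-low : ∀ q s L → 1 ≤ s → s ≤ 4 + l → 2 * (s * q) + s ≤ s * s →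
      Unique L → L ⊑ U → (∀ {x} → x ∈ L → degree U x ≤ q) → s ≤ length L → Bounded U
    delete-low q s L 1≤s s≤N cheap uL L⊑U low s≤ =
      delete S (Uniqueₚ.take⁺ s uL) (L⊑U ∘ take-⊆ s L) (≤-trans 1≤s (≤-reflexive (sym len)))
        (≤-trans (≤-reflexive len) s≤N)
        (cost-degrees S uU (Uniqueₚ.take⁺ s uL) (L⊑U ∘ take-⊆ s L) (low ∘ take-⊆ s L))
        (subst (λ s → 2 * (s * q) + s ≤ s * s) (sym len) cheap)
      where
      S : List V
      S = take s L
      len : length S ≡ s
      len = trans (length-take s L) (m≤n⇒m⊓n≡m s≤)

    delete-closed : ∀ S → Unique S → S ⊑ U → 1 ≤ length S → length S ≤ 4 + l →
      (∀ {x y} → x ∈ S → y ∈ U → x ~ y → y ∈ S) → Bounded U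
    delete-closed S uS S⊑U 1≤s s≤N closed =
      delete S uS S⊑U 1≤s s≤N (cost-closed S uU uS S⊑U closed) (≤-reflexive (2*triangular (length S)))

    -- All edges that leave S go to c. Although c may have neighbours elsewhere, its degree is at
    -- most what it would be in a clique on `c ∷ S`, so the total is still that of a clique.
    delete-cut : ∀ c S → c ∈ U → Unique S → c ∉ S → S ⊑ U → degree U c ≤ length S → 1 + length S ≤ 4 + l →
      (∀ {x y} → x ∈ S → y ∈ U → x ~ y → y ≢ c → y ∈ S) → Bounded U
    delete-cut c S c∈U uS c∉S S⊑U deg≤ s≤N closed =
      delete (c ∷ S) ucS cS⊑U (s≤s z≤n) s≤N
        (cost-∷ S uU c∈U deg≤
          (cost-closed S (Unique-─ c uU) uS (⊑-─ ucS cS⊑U)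
            (λ x∈S y∈ x~y → let y∈U , y≢c = ∈-─⁻ y∈ in closed x∈S y∈U x~y y≢c)))
        (≤-reflexive (2*triangular (suc (length S))))
      where
      ucS : Unique (c ∷ S)
      ucS = All.tabulate (λ y∈S c≡y → c∉S (subst (_∈ S) (sym c≡y) y∈S)) ∷ uS
      cS⊑U : (c ∷ S) ⊑ U
      cS⊑U (here refl) = c∈U
      cS⊑U (there y∈S) = S⊑U y∈S

    module Around (v : V) (v∈U : v ∈ U) where

      Γ : List V
      Γ = filter (λ y → adj G v y Bool.≟ true) U

      degree≡ : degree U v ≡ length Γ
      degree≡ = count-filter (adj G v) U

      uΓ : Unique Γ
      uΓ = Uniqueₚ.filter⁺ _ uU

      Γ⊑U : Γ ⊑ U
      Γ⊑U y∈Γ = proj₁ (∈-filter⁻ (λ y → adj G v y Bool.≟ true) y∈Γ)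

      v~Γ : ∀ {y} → y ∈ Γ → v ~ y
      v~Γ y∈Γ = proj₂ (∈-filter⁻ (λ y → adj G v y Bool.≟ true) {xs = U} y∈Γ)

      ∈Γ : ∀ {y} → y ∈ U → v ~ y → y ∈ Γ
      ∈Γ = ∈-filter⁺ (λ y → adj G v y Bool.≟ true)

      Γ≢v : ∀ {y} → y ∈ Γ → y ≢ v
      Γ≢v y∈Γ y≡v = ~⇒≢ (v~Γ y∈Γ) (sym y≡v)

      Γ≢∉ : ∀ {y z} → y ∈ Γ → z ∉ Γ → y ≢ z
      Γ≢∉ y∈Γ z∉Γ y≡z = z∉Γ (subst (_∈ Γ) y≡z y∈Γ)

      uvΓ : ∀ {S} → S ⊑ Γ → Unique S → Unique (v ∷ S)
      uvΓ S⊑Γ uS = All.tabulate (λ y∈S v≡y → Γ≢v (S⊑Γ y∈S) (sym v≡y)) ∷ uS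

      vΓ⊑U : ∀ {S} → S ⊑ Γ → (v ∷ S) ⊑ U
      vΓ⊑U S⊑Γ (here refl) = v∈U
      vΓ⊑U S⊑Γ (there y∈S) = Γ⊑U (S⊑Γ y∈S)

      Γ─⊑Γ : ∀ x → (Γ ─ x) ⊑ Γ
      Γ─⊑Γ x y∈ = proj₁ (∈-─⁻ y∈)

      module _ {a a′ b b′} (a∈Γ : a ∈ Γ) (a′∈Γ : a′ ∈ Γ) (a~b : a ~ b) (a′~b′ : a′ ~ b′)
               (b≢v : b ≢ v) (b′≢v : b′ ≢ v)
               (a≢a′ : a ≢ a′) (a≢b′ : a ≢ b′) (a′≢b : a′ ≢ b) (b≢b′ : b ≢ b′) where

        private
          u₁ = Unique-─ a uΓ
          u₂ = Unique-─ a′ u₁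
          u₃ = Unique-─ b u₂

          two : length Γ ≤ 2 + length (Γ ─ a ─ a′)
          two = ≤-trans (length≤─ a uΓ) (s≤s (length≤─ a′ u₁))

          ∉─₂ : ∀ {y} → y ∉ Γ → y ∉ Γ ─ a ─ a′
          ∉─₂ y∉Γ y∈ = y∉Γ (proj₁ (∈-─⁻ (proj₁ (∈-─⁻ y∈))))

          forbidden : l ≤ length (Γ ─ a ─ a′ ─ b ─ b′) → ⊥
          forbidden l≤ = T-free (neighbourhood-spider G (v~Γ a∈Γ) (v~Γ a′∈Γ) a~b a′~b′
            a≢a′ a≢b′ a′≢b b≢b′ b≢v b′≢v uΓ v~Γ l≤)

        -- The tree needs l further neighbours of v. Each of a and a′ uses one up, and so does each
        -- of b and b′ that lies in Γ. The degree required is therefore l + 4, and it drops by one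
        -- for each of b and b′ outside Γ, as in the two variants that follow.
        no-disjoint : 4 + l ≤ length Γ → ⊥
        no-disjoint N≤ = forbidden (+-cancelˡ-≤ 4 _ _ (≤-trans N≤ (≤-trans two
          (s≤s (s≤s (≤-trans (length≤─ b u₂) (s≤s (length≤─ b′ u₃))))))))

        no-disjoint-half : 3 + l ≤ length Γ → b ∉ Γ → ⊥
        no-disjoint-half N≤ b∉Γ = forbidden (+-cancelˡ-≤ 3 _ _ (≤-trans N≤ (≤-trans two
          (s≤s (s≤s (≤-trans (≤-reflexive (cong length (sym (─-∉ (∉─₂ b∉Γ))))) (length≤─ b′ u₃)))))))

        no-disjoint-crossing : 2 + l ≤ length Γ → b ∉ Γ → b′ ∉ Γ → ⊥
        no-disjoint-crossing N≤ b∉Γ b′∉Γ = forbidden (+-cancelˡ-≤ 2 _ _ (≤-trans N≤ (≤-trans two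
          (s≤s (s≤s (≤-reflexive (cong length (trans (sym (─-∉ (∉─₂ b∉Γ)))
            (sym (─-∉ (λ b′∈ → ∉─₂ b′∉Γ (proj₁ (∈-─⁻ b′∈)))))))))))))

      -- Here v and Γ already make up N vertices, so b cannot be deleted with them. But two edges
      -- enter b, and every other edge at Γ has to meet them: besides v, the vertex a sees only b
      -- and x, and once v and a are gone the other vertices of Γ see only b. So v and Γ meet few
      -- edges even though some of these lead to b.
      dense : length Γ ≡ 3 + l → ∀ {a b x} → a ∈ Γ → a ~ b → b ≢ v → b ∉ Γ →
        x ∈ Γ → x ≢ a → x ~ b → Bounded U
      dense m≡ {a} {b} {x} a∈Γ a~b b≢v b∉Γ x∈Γ x≢a x~b = by-size l refl
        where
        len : length (Γ ─ a) ≡ 2 + l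
        len = suc-injective (trans (sym (length-─ uΓ a∈Γ)) m≡)
        S : List V
        S = v ∷ a ∷ (Γ ─ a)
        aΓ⊑Γ : (a ∷ (Γ ─ a)) ⊑ Γ
        aΓ⊑Γ (here refl) = a∈Γ
        aΓ⊑Γ (there y∈)  = Γ─⊑Γ a y∈
        uaΓ : Unique (a ∷ (Γ ─ a))
        uaΓ = All.tabulate (λ y∈ a≡y → proj₂ (∈-─⁻ y∈) (sym a≡y)) ∷ Unique-─ a uΓ
        uS : Unique S
        uS = uvΓ aΓ⊑Γ uaΓ
        S⊑U : S ⊑ U
        S⊑U = vΓ⊑U aΓ⊑Γ
        S─⊑ : (a ∷ (Γ ─ a)) ⊑ (U ─ v)
        S─⊑ = ⊑-─ uS S⊑U
        a-nbr : ∀ {z} → z ≢ v → a ~ z → z ≡ b ⊎ z ≡ x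
        a-nbr {z} z≢v a~z with z ≟ b | z ≟ x
        ... | yes z≡b | _       = inj₁ z≡b
        ... | no _    | yes z≡x = inj₂ z≡x
        ... | no z≢b  | no z≢x  = ⊥-elim (no-disjoint-half x∈Γ a∈Γ x~b a~z b≢v z≢v
          x≢a (z≢x ∘ sym) (Γ≢∉ a∈Γ b∉Γ) (z≢b ∘ sym) (≤-reflexive (sym m≡)) b∉Γ)
        low : ∀ {y} → y ∈ Γ ─ a → degree (U ─ v ─ a) y ≤ 1
        low {y} y∈ = count≤length (Unique-─ a (Unique-─ v uU)) nbr
          where
          nbr : ∀ {z} → z ∈ U ─ v ─ a → y ~ z → z ∈ b ∷ []
          nbr {z} z∈ y~z with z ≟ b
          ... | yes z≡b = here z≡b
          ... | no z≢b  =
            let z∈₁ , z≢a = ∈-─⁻ z∈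
                _   , z≢v = ∈-─⁻ z∈₁
                y∈Γ , y≢a = ∈-─⁻ y∈
            in ⊥-elim (no-disjoint-half a∈Γ y∈Γ a~b y~z b≢v z≢v
                 (y≢a ∘ sym) (z≢a ∘ sym) (Γ≢∉ y∈Γ b∉Γ) (z≢b ∘ sym) (≤-reflexive (sym m≡)) b∉Γ)
        close : ∀ q → degree (U ─ v) a ≤ q → 2 * ((3 + l) + (q + (2 + l) * 1)) + (4 + l) ≤ (4 + l) * (4 + l) → Bounded U
        close q deg≤q cheap = delete S {(3 + l) + (q + length (Γ ─ a) * 1)} uS S⊑U (s≤s z≤n)
          (≤-reflexive (cong (2 +_) len))
          (cost-∷ (a ∷ (Γ ─ a)) uU v∈U (≤-reflexive (trans degree≡ m≡))
            (cost-∷ (Γ ─ a) (Unique-─ v uU) (S─⊑ (here refl)) deg≤q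
              (cost-degrees (Γ ─ a) (Unique-─ a (Unique-─ v uU)) (Unique-─ a uΓ) (⊑-─ uaΓ S─⊑) low)))
          (subst (λ k → 2 * ((3 + l) + (q + k * 1)) + (2 + k) ≤ (2 + k) * (2 + k)) (sym len) cheap)
        -- For P₅ the edge ax is forbidden, which saves the one edge that would spoil the count.
        by-size : ∀ l′ → l ≡ l′ → Bounded U
        by-size zero l≡0 = close 1
          (count≤length (Unique-─ v uU) only-b)
          (subst (λ l → 2 * ((3 + l) + (1 + (2 + l) * 1)) + (4 + l) ≤ (4 + l) * (4 + l)) (sym l≡0) ≤-refl)
          where
          a≁x : a ~ x → ⊥
          a≁x a~x with Γ ─ a ─ x in eq | ≤-trans (≤-reflexive (sym len)) (length≤─ x (Unique-─ a uΓ))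
          ... | []    | s≤s ()
          ... | t ∷ _ | _ =
            -- A third neighbour t of v begins the path t, v, a, x, b.
            let t∈₁ , t≢x = ∈-─⁻ {Γ ─ a} (subst (t ∈_) (sym eq) (here refl))
                t∈Γ , t≢a = ∈-─⁻ t∈₁
            in P₅-free l≡0 (~-sym (v~Γ t∈Γ)) (v~Γ a∈Γ) a~x x~b
                 (Γ≢v x∈Γ ∘ sym) (b≢v ∘ sym) (t≢x ∘ sym) (Γ≢∉ t∈Γ b∉Γ) t≢a (Γ≢∉ a∈Γ b∉Γ ∘ sym)
          only-b : ∀ {z} → z ∈ U ─ v → a ~ z → z ∈ b ∷ []
          only-b z∈ a~z with a-nbr (proj₂ (∈-─⁻ z∈)) a~z
          ... | inj₁ z≡b  = here z≡b
          ... | inj₂ refl = ⊥-elim (a≁x a~z)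
        by-size (suc l′) l≡ = close 2
          (count≤length (Unique-─ v uU) b-or-x)
          (subst (λ l → 2 * ((3 + l) + (2 + (2 + l) * 1)) + (4 + l) ≤ (4 + l) * (4 + l)) (sym l≡)
            (≤-trans (m≤m+n _ (2 + 5 * l′ + l′ * l′)) (≤-reflexive (expand l′))))
          where
          expand : ∀ l′ → 2 * ((4 + l′) + (2 + (3 + l′) * 1)) + (5 + l′) + (2 + 5 * l′ + l′ * l′) ≡ (5 + l′) * (5 + l′)
          expand = solve-∀
          b-or-x : ∀ {z} → z ∈ U ─ v → a ~ z → z ∈ b ∷ x ∷ []
          b-or-x z∈ a~z with a-nbr (proj₂ (∈-─⁻ z∈)) a~z
          ... | inj₁ z≡b = here z≡b
          ... | inj₂ z≡x = there (here z≡x)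

      -- Any two edges from Γ to the outside of Γ and v meet, so all of them share an end, either
      -- some a in Γ or some b outside. That end is a cut vertex, and by maximality its degree is at
      -- most the size of Γ, as `delete-cut` demands.
      bounded-middle : 2 + l ≤ length Γ → length Γ ≤ 3 + l → (∀ {x} → x ∈ U → degree U x ≤ length Γ) → Bounded U
      bounded-middle 2+l≤m m≤3+l max with search (λ a → any? (λ b → (a ~? b) ×-dec (¬? (b ≟ v) ×-dec ¬? (b ∈? Γ))) U) Γ
      ... | inj₂ none = delete-closed (v ∷ Γ) (uvΓ id uΓ) (vΓ⊑U id) (s≤s z≤n) (s≤s m≤3+l) closed
        where
        closed : ∀ {y z} → y ∈ v ∷ Γ → z ∈ U → y ~ z → z ∈ v ∷ Γ
        closed (here refl) z∈U v~z = there (∈Γ z∈U v~z)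
        closed {z = z} (there y∈Γ) z∈U y~z with z ≟ v | z ∈? Γ
        ... | yes z≡v | _       = here z≡v
        ... | no _    | yes z∈Γ = there z∈Γ
        ... | no z≢v  | no z∉Γ  = ⊥-elim (none y∈Γ (lose z∈U (y~z , z≢v , z∉Γ)))
      ... | inj₁ (a , a∈Γ , any-b) with find any-b
      ...   | b , b∈U , a~b , b≢v , b∉Γ with search (λ x → x ~? b) (Γ ─ a)
      ...     | inj₂ none = delete-cut a (v ∷ (Γ ─ a)) (Γ⊑U a∈Γ) (uvΓ (Γ─⊑Γ a) (Unique-─ a uΓ)) a∉ (vΓ⊑U (Γ─⊑Γ a))
                (≤-trans (max (Γ⊑U a∈Γ)) (≤-reflexive (length-─ uΓ a∈Γ)))
                (≤-trans (≤-reflexive (cong suc (sym (length-─ uΓ a∈Γ)))) (s≤s m≤3+l)) closed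
        where
        a∉ : a ∉ v ∷ (Γ ─ a)
        a∉ (here a≡v) = Γ≢v a∈Γ a≡v
        a∉ (there a∈) = proj₂ (∈-─⁻ a∈) refl
        closed : ∀ {y z} → y ∈ v ∷ (Γ ─ a) → z ∈ U → y ~ z → z ≢ a → z ∈ v ∷ (Γ ─ a)
        closed (here refl) z∈U v~z z≢a = there (∈-─⁺ (∈Γ z∈U v~z) z≢a)
        closed {y} {z} (there y∈) z∈U y~z z≢a with z ≟ v | z ∈? Γ
        ... | yes z≡v | _       = here z≡v
        ... | no _    | yes z∈Γ = there (∈-─⁺ z∈Γ z≢a)
        ... | no z≢v  | no z∉Γ  =
          let y∈Γ , y≢a = ∈-─⁻ y∈
          in ⊥-elim (no-disjoint-crossing a∈Γ y∈Γ a~b y~z b≢v z≢v (y≢a ∘ sym) (Γ≢∉ a∈Γ z∉Γ) (Γ≢∉ y∈Γ b∉Γ)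
               (λ b≡z → none y∈ (subst (y ~_) (sym b≡z) y~z)) 2+l≤m b∉Γ z∉Γ)
      ...     | inj₁ (x , x∈ , x~b) with ∈-─⁻ x∈ | m≤n⇒m<n∨m≡n m≤3+l
      -- Together v, Γ and b would be N + 1 vertices, too many to delete.
      ...       | x∈Γ , x≢a | inj₂ m≡3+l = dense m≡3+l a∈Γ a~b b≢v b∉Γ x∈Γ x≢a x~b
      ...       | x∈Γ , x≢a | inj₁ m<3+l = delete-cut b (v ∷ Γ) b∈U (uvΓ id uΓ) b∉ (vΓ⊑U id)
                  (≤-trans (max b∈U) (n≤1+n _)) (s≤s m<3+l) closed
        where
        b∉ : b ∉ v ∷ Γ
        b∉ (here b≡v)  = b≢v b≡v
        b∉ (there b∈Γ) = b∉Γ b∈Γ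
        closed : ∀ {y z} → y ∈ v ∷ Γ → z ∈ U → y ~ z → z ≢ b → z ∈ v ∷ Γ
        closed (here refl) z∈U v~z z≢b = there (∈Γ z∈U v~z)
        closed {y} {z} (there y∈Γ) z∈U y~z z≢b with z ≟ v | z ∈? Γ
        ... | yes z≡v | _       = here z≡v
        ... | no _    | yes z∈Γ = there z∈Γ
        -- An edge y z with z different from b is disjoint from x b if y is a, and from a b
        -- otherwise.
        ... | no z≢v  | no z∉Γ with y ≟ a
        ...   | yes refl = ⊥-elim (no-disjoint-crossing x∈Γ a∈Γ x~b y~z b≢v z≢v x≢a (Γ≢∉ x∈Γ z∉Γ) (Γ≢∉ a∈Γ b∉Γ)
                             (z≢b ∘ sym) 2+l≤m b∉Γ z∉Γ)
        ...   | no y≢a   = ⊥-elim (no-disjoint-crossing a∈Γ y∈Γ a~b y~z b≢v z≢v (y≢a ∘ sym) (Γ≢∉ a∈Γ z∉Γ) (Γ≢∉ y∈Γ b∉Γ)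
                             (z≢b ∘ sym) 2+l≤m b∉Γ z∉Γ)

      record Touch (y z : V) : Set where
        constructor touch
        field
          edge : y ~ z
          y≢v  : y ≢ v
          z≢v  : z ≢ v
          near : y ∈ Γ ⊎ z ∈ Γ

      touchΓ : ∀ {y z} → y ∈ Γ → y ~ z → z ≢ v → Touch y z
      touchΓ y∈Γ y~z z≢v = touch y~z (Γ≢v y∈Γ) z≢v (inj₁ y∈Γ)

      leaf : ∀ {y} → (∀ {z} → y ~ z → z ≢ v → ⊥) → degree U y ≤ 1
      leaf {y} none = count≤length {Z = v ∷ []} uU nbr
        where
        nbr : ∀ {z} → z ∈ U → y ~ z → z ∈ v ∷ []
        nbr {z} _ y~z with z ≟ v
        ... | yes z≡v = here z≡v
        ... | no z≢v  = ⊥-elim (none y~z z≢v)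

      -- Three vertices of degree at most 1 meet at most three edges, as many as a triangle has.
      three-leaves : ∀ {L} → Unique L → L ⊑ Γ → 3 ≤ length L →
        (∀ {y z} → y ∈ L → y ~ z → z ≢ v → ⊥) → Bounded U
      three-leaves {L} uL L⊑Γ 3≤ none = delete-low 1 3 L (s≤s z≤n) (s≤s (s≤s (s≤s z≤n))) ≤-refl uL (Γ⊑U ∘ L⊑Γ)
        (λ y∈L → leaf (none y∈L)) 3≤

      -- A vertex of degree at least N

      module High (N≤m : 4 + l ≤ length Γ) where

        -- Each edge is oriented so as to start in Γ, whence four cases. It follows that the edges
        -- away from v that touch Γ form a star or lie in a triangle.
        meet : ∀ {y z y′ z′} → Touch y z → Touch y′ z′ → y ≢ y′ → y ≢ z′ → z ≢ y′ → z ≢ z′ → ⊥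
        meet (touch e y≢v z≢v (inj₁ y∈)) (touch e′ y′≢v z′≢v (inj₁ y′∈)) yy yz zy zz =
          no-disjoint y∈ y′∈ e e′ z≢v z′≢v yy yz (zy ∘ sym) zz N≤m
        meet (touch e y≢v z≢v (inj₁ y∈)) (touch e′ y′≢v z′≢v (inj₂ z′∈)) yy yz zy zz =
          no-disjoint y∈ z′∈ e (~-sym e′) z≢v y′≢v yz yy (zz ∘ sym) zy N≤m
        meet (touch e y≢v z≢v (inj₂ z∈)) (touch e′ y′≢v z′≢v (inj₁ y′∈)) yy yz zy zz =
          no-disjoint z∈ y′∈ (~-sym e) e′ y≢v z′≢v zy zz (yy ∘ sym) yz N≤m
        meet (touch e y≢v z≢v (inj₂ z∈)) (touch e′ y′≢v z′≢v (inj₂ z′∈)) yy yz zy zz =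
          no-disjoint z∈ z′∈ (~-sym e) (~-sym e′) y≢v y′≢v zz zy (yz ∘ sym) yy N≤m

        module _ (1≤l : 1 ≤ l) {x c o} (x∈Γ : x ∈ Γ) (xc : Touch x c) (co : Touch c o)
                 (x≢c : x ≢ c) (x≢o : x ≢ o) (c≢o : c ≢ o) where

          private
            5≤m : 5 ≤ length Γ
            5≤m = ≤-trans (+-monoʳ-≤ 4 1≤l) N≤m
            5≤N : 5 ≤ 4 + l
            5≤N = +-monoʳ-≤ 4 1≤l

          -- An edge from another vertex of Γ to a corner misses the opposite side, so the rest of Γ
          -- consists of leaves at v. There are three of them if c or o is outside Γ. Otherwise two
          -- leaves are deleted with the triangle; these five vertices meet at most 3 + 2 + 1 + 2 =
          -- 8 edges, and 10 are allowed.
          bounded-triangle : x ~ o → Bounded U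
          bounded-triangle x~o = by-membership (c ∈? Γ) (o ∈? Γ)
            where
            xo : Touch x o
            xo = touchΓ x∈Γ x~o (Touch.z≢v co)
            L : List V
            L = Γ ─ x ─ c ─ o
            u₁ = Unique-─ x uΓ
            u₂ = Unique-─ c u₁
            uL : Unique L
            uL = Unique-─ o u₂
            L⊑Γ : L ⊑ Γ
            L⊑Γ y∈ = proj₁ (∈-─⁻ (proj₁ (∈-─⁻ (proj₁ (∈-─⁻ y∈)))))
            leaves : ∀ {y z} → y ∈ L → y ~ z → z ≢ v → ⊥
            leaves {y} {z} y∈ y~z z≢v =
              let y∈₂ , y≢o = ∈-─⁻ y∈
                  y∈₁ , y≢c = ∈-─⁻ y∈₂
                  y∈Γ , y≢x = ∈-─⁻ y∈₁
              in go y∈Γ y≢x y≢c y≢o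
              where
              go : y ∈ Γ → y ≢ x → y ≢ c → y ≢ o → ⊥
              go y∈Γ y≢x y≢c y≢o with z ≟ x | z ≟ c
              ... | yes refl | _        = meet (touchΓ y∈Γ y~z z≢v) co y≢c y≢o x≢c x≢o
              ... | no _     | yes refl = meet (touchΓ y∈Γ y~z z≢v) xo y≢x y≢o (x≢c ∘ sym) c≢o
              ... | no z≢x   | no z≢c   = meet (touchΓ y∈Γ y~z z≢v) xc y≢x y≢c z≢x z≢c
            3≤Γ─x─c : 3 ≤ length (Γ ─ x ─ c)
            3≤Γ─x─c = +-cancelˡ-≤ 2 _ _ (≤-trans 5≤m (≤-trans (length≤─ x uΓ) (s≤s (length≤─ c u₁))))
            by-membership : Dec (c ∈ Γ) → Dec (o ∈ Γ) → Bounded U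
            by-membership (no c∉Γ) _ = three-leaves uL L⊑Γ
              (+-cancelˡ-≤ 2 _ _ (≤-trans 5≤m (≤-trans (length≤─ x uΓ)
                (s≤s (≤-trans (≤-reflexive (cong length (sym (─-∉ (λ c∈ → c∉Γ (proj₁ (∈-─⁻ c∈))))))) (length≤─ o u₂))))))
              leaves
            by-membership (yes _) (no o∉Γ) = three-leaves uL L⊑Γ
              (≤-trans 3≤Γ─x─c (≤-reflexive (cong length (sym (─-∉ (λ o∈ → o∉Γ (proj₁ (∈-─⁻ (proj₁ (∈-─⁻ o∈)))))))))) leaves
            by-membership (yes c∈Γ) (yes o∈Γ) = delete S {3 + (2 + (1 + length (take 2 L) * 1))} uS S⊑U (s≤s z≤n)
              (≤-trans (≤-reflexive (cong (3 +_) len)) 5≤N)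
              (cost-∷ (c ∷ o ∷ take 2 L) uU (S⊑U (here refl)) (count≤length uU x-nbr)
                (cost-∷ (o ∷ take 2 L) uU₁ (S⊑U₁ (here refl)) (count≤length uU₁ c-nbr)
                  (cost-∷ (take 2 L) uU₂ (S⊑U₂ (here refl)) (count≤length uU₂ o-nbr)
                    (cost-degrees (take 2 L) (Unique-─ o uU₂) utake (⊑-─ uo S⊑U₂) low))))
              (subst (λ k → 2 * (3 + (2 + (1 + k * 1))) + (3 + k) ≤ (3 + k) * (3 + k)) (sym len) (m≤m+n 21 4))
              where
              S : List V
              S = x ∷ c ∷ o ∷ take 2 L
              utake : Unique (take 2 L)
              utake = Uniqueₚ.take⁺ 2 uL
              len : length (take 2 L) ≡ 2
              len = trans (length-take 2 L) (m≤n⇒m⊓n≡m (+-cancelˡ-≤ 1 _ _ (≤-trans 3≤Γ─x─c (length≤─ o u₂))))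
              uo : Unique (o ∷ take 2 L)
              uo = All.tabulate (λ y∈ o≡y → proj₂ (∈-─⁻ (take-⊆ 2 L y∈)) (sym o≡y)) ∷ utake
              uc : Unique (c ∷ o ∷ take 2 L)
              uc = (c≢o ∷ All.tabulate (λ y∈ c≡y → proj₂ (∈-─⁻ (proj₁ (∈-─⁻ (take-⊆ 2 L y∈)))) (sym c≡y))) ∷ uo
              uS : Unique S
              uS = (x≢c ∷ x≢o ∷ All.tabulate (λ y∈ x≡y → proj₂ (∈-─⁻ (proj₁ (∈-─⁻ (proj₁ (∈-─⁻ (take-⊆ 2 L y∈)))))) (sym x≡y))) ∷ uc
              S⊑U : S ⊑ U
              S⊑U (here refl)                 = Γ⊑U x∈Γ
              S⊑U (there (here refl))         = Γ⊑U c∈Γ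
              S⊑U (there (there (here refl))) = Γ⊑U o∈Γ
              S⊑U (there (there (there y∈)))  = Γ⊑U (L⊑Γ (take-⊆ 2 L y∈))
              uU₁ = Unique-─ x uU
              uU₂ = Unique-─ c uU₁
              S⊑U₁ : (c ∷ o ∷ take 2 L) ⊑ (U ─ x)
              S⊑U₁ = ⊑-─ uS S⊑U
              S⊑U₂ : (o ∷ take 2 L) ⊑ (U ─ x ─ c)
              S⊑U₂ = ⊑-─ uc S⊑U₁
              x-nbr : ∀ {z} → z ∈ U → x ~ z → z ∈ v ∷ c ∷ o ∷ []
              x-nbr {z} _ x~z with z ≟ v | z ≟ c | z ≟ o
              ... | yes z≡v | _       | _       = here z≡v
              ... | no _    | yes z≡c | _       = there (here z≡c)
              ... | no _    | no _    | yes z≡o = there (there (here z≡o))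
              ... | no z≢v  | no z≢c  | no z≢o  = ⊥-elim (meet (touchΓ x∈Γ x~z z≢v) co x≢c x≢o z≢c z≢o)
              c-nbr : ∀ {z} → z ∈ U ─ x → c ~ z → z ∈ v ∷ o ∷ []
              c-nbr {z} z∈ c~z with z ≟ v | z ≟ o
              ... | yes z≡v | _       = here z≡v
              ... | no _    | yes z≡o = there (here z≡o)
              ... | no z≢v  | no z≢o  = ⊥-elim (meet (touchΓ c∈Γ c~z z≢v) xo (x≢c ∘ sym) c≢o (proj₂ (∈-─⁻ z∈)) z≢o)
              o-nbr : ∀ {z} → z ∈ U ─ x ─ c → o ~ z → z ∈ v ∷ []
              o-nbr {z} z∈ o~z with z ≟ v
              ... | yes z≡v = here z≡v
              ... | no z≢v  =
                let z∈₁ , z≢c = ∈-─⁻ z∈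
                    _   , z≢x = ∈-─⁻ z∈₁
                in ⊥-elim (meet (touchΓ o∈Γ o~z z≢v) xc (x≢o ∘ sym) (c≢o ∘ sym) z≢x z≢c)
              low : ∀ {y} → y ∈ take 2 L → degree (U ─ x ─ c ─ o) y ≤ 1
              low {y} y∈ = ≤-trans (degree-─ y uU₂ (S⊑U₂ (here refl)))
                (≤-trans (degree-─ y uU₁ (S⊑U₁ (here refl)))
                  (≤-trans (degree-─ y uU (S⊑U (here refl))) (leaf (leaves (take-⊆ 2 L y∈)))))

          -- An edge at Γ that avoids v and c would have to meet both x c and c o, hence be x o. So
          -- vertices of Γ other than c see only v and c. Five of them meet at most 10 edges. If
          -- there are just four, v has degree at most 5 and is deleted with them, at a cost of 5 +
          -- 4 = 9 where 10 is allowed.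
          bounded-star : ¬ x ~ o → Bounded U
          bounded-star x≁o = by-size (5 ≤? length (Γ ─ c))
            where
            centred : ∀ {y z} → y ∈ Γ ─ c → y ~ z → z ≢ v → z ≢ c → ⊥
            centred {y} {z} y∈ y~z z≢v z≢c with ∈-─⁻ y∈ | y ≟ x | z ≟ x | y ≟ o | z ≟ o
            ... | y∈Γ , y≢c | yes refl | _        | _        | yes refl = x≁o y~z
            ... | y∈Γ , y≢c | yes refl | _        | _        | no z≢o   = meet (touchΓ y∈Γ y~z z≢v) co y≢c x≢o z≢c z≢o
            ... | y∈Γ , y≢c | no y≢x   | yes refl | yes refl | _        = x≁o (~-sym y~z)
            ... | y∈Γ , y≢c | no y≢x   | yes refl | no y≢o   | _        = meet (touchΓ y∈Γ y~z z≢v) co y≢c y≢o z≢c x≢o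
            ... | y∈Γ , y≢c | no y≢x   | no z≢x   | _        | _        = meet (touchΓ y∈Γ y~z z≢v) xc y≢x y≢c z≢x z≢c
            nbr : ∀ {y} → y ∈ Γ ─ c → ∀ z → y ~ z → z ∈ v ∷ c ∷ []
            nbr y∈ z y~z with z ≟ v | z ≟ c
            ... | yes z≡v | _       = here z≡v
            ... | no _    | yes z≡c = there (here z≡c)
            ... | no z≢v  | no z≢c  = ⊥-elim (centred y∈ y~z z≢v z≢c)
            by-size : Dec (5 ≤ length (Γ ─ c)) → Bounded U
            by-size (yes 5≤) = delete-low 2 5 (Γ ─ c) (s≤s z≤n) 5≤N ≤-refl (Unique-─ c uΓ) (Γ⊑U ∘ Γ─⊑Γ c)
              (λ y∈ → count≤length {Z = v ∷ c ∷ []} uU (λ {z} _ → nbr y∈ z)) 5≤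
            by-size (no 5≰) = delete S {5 + length (Γ ─ c) * 1} uS S⊑U (s≤s z≤n)
              (≤-trans (≤-reflexive (cong suc len)) 5≤N)
              (cost-∷ (Γ ─ c) uU v∈U
                (≤-trans (≤-reflexive degree≡) (≤-trans (length≤─ c uΓ) (s≤s (≤-reflexive len))))
                (cost-degrees (Γ ─ c) (Unique-─ v uU) (Unique-─ c uΓ) (⊑-─ uS S⊑U)
                  (λ y∈ → count≤length {Z = c ∷ []} (Unique-─ v uU) (nbr′ y∈))))
              (subst (λ k → 2 * (5 + k * 1) + (1 + k) ≤ (1 + k) * (1 + k)) (sym len) (m≤m+n 23 2))
              where
              S : List V
              S = v ∷ (Γ ─ c)
              uS : Unique S
              uS = uvΓ (Γ─⊑Γ c) (Unique-─ c uΓ)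
              S⊑U : S ⊑ U
              S⊑U = vΓ⊑U (Γ─⊑Γ c)
              len : length (Γ ─ c) ≡ 4
              len = ≤-antisym (≤-pred (≰⇒> 5≰)) (+-cancelˡ-≤ 1 _ _ (≤-trans 5≤m (length≤─ c uΓ)))
              nbr′ : ∀ {y} → y ∈ Γ ─ c → ∀ {z} → z ∈ U ─ v → y ~ z → z ∈ c ∷ []
              nbr′ y∈ {z} z∈ y~z with nbr y∈ z y~z
              ... | here z≡v  = ⊥-elim (proj₂ (∈-─⁻ z∈) z≡v)
              ... | there z∈c = z∈c

        module Edge {a b} (a∈Γ : a ∈ Γ) (a~b : a ~ b) (b≢v : b ≢ v) where

          private
            L : List V
            L = Γ ─ a ─ b
            u₁ = Unique-─ a uΓ
            uL : Unique L
            uL = Unique-─ b u₁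
            L⊑Γ : L ⊑ Γ
            L⊑Γ y∈ = Γ─⊑Γ a (proj₁ (∈-─⁻ y∈))
            a≢b : a ≢ b
            a≢b = ~⇒≢ a~b
            ab : Touch a b
            ab = touchΓ a∈Γ a~b b≢v
            m≤2+L : 2 + (2 + l) ≤ 2 + length L
            m≤2+L = ≤-trans N≤m (≤-trans (length≤─ a uΓ) (s≤s (length≤─ b u₁)))
            far : ∀ {y z} → y ∈ L → y ~ z → z ≢ v → z ≢ a → z ≢ b → ⊥
            far y∈ y~z z≢v z≢a z≢b =
              let y∈₁ , y≢b = ∈-─⁻ y∈
                  y∈Γ , y≢a = ∈-─⁻ y∈₁
              in meet (touchΓ y∈Γ y~z z≢v) ab y≢a y≢b z≢a z≢b

          -- All edges from L to vertices other than v end in a or b. If there are none, L provides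
          -- three leaves. Otherwise some x in L extends a b to a path of two edges, and its
          -- possible third side separates triangle from star.
          bounded-edge-long : 1 ≤ l → Bounded U
          bounded-edge-long 1≤l with search (λ x → (x ~? a) ⊎-dec (x ~? b)) L
          ... | inj₂ none = three-leaves uL L⊑Γ (≤-trans (+-monoʳ-≤ 2 1≤l) (+-cancelˡ-≤ 2 _ _ m≤2+L)) leaves
            where
            leaves : ∀ {y z} → y ∈ L → y ~ z → z ≢ v → ⊥
            leaves {y} {z} y∈ y~z z≢v = far y∈ y~z z≢v
              (λ z≡a → none y∈ (inj₁ (subst (y ~_) z≡a y~z)))
              (λ z≡b → none y∈ (inj₂ (subst (y ~_) z≡b y~z)))
          ... | inj₁ (x , x∈ , x~) = hub x~
            where
            x∈Γ : x ∈ Γ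
            x∈Γ = L⊑Γ x∈
            x≢b : x ≢ b
            x≢b = proj₂ (∈-─⁻ x∈)
            x≢a : x ≢ a
            x≢a = proj₂ (∈-─⁻ (proj₁ (∈-─⁻ x∈)))
            hub : x ~ a ⊎ x ~ b → Bounded U
            hub (inj₁ x~a) with x ~? b
            ... | yes x~b = bounded-triangle 1≤l x∈Γ (touchΓ x∈Γ x~a (Γ≢v a∈Γ)) ab x≢a x≢b a≢b x~b
            ... | no x≁b  = bounded-star 1≤l x∈Γ (touchΓ x∈Γ x~a (Γ≢v a∈Γ)) ab x≢a x≢b a≢b x≁b
            hub (inj₂ x~b) with x ~? a
            ... | yes x~a = bounded-triangle 1≤l x∈Γ (touchΓ x∈Γ x~b b≢v) ba x≢b x≢a (a≢b ∘ sym) x~a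
              where ba = touch (~-sym a~b) b≢v (Γ≢v a∈Γ) (inj₂ a∈Γ)
            ... | no x≁a  = bounded-star 1≤l x∈Γ (touchΓ x∈Γ x~b b≢v) ba x≢b x≢a (a≢b ∘ sym) x≁a
              where ba = touch (~-sym a~b) b≢v (Γ≢v a∈Γ) (inj₂ a∈Γ)

          bounded-edge-short : l ≡ 0 → Bounded U
          bounded-edge-short l≡0 = by-membership (b ∈? Γ)
            where
            other : ∀ z → ∃[ t ] (t ∈ Γ × t ≢ a × t ≢ b × t ≢ z)
            -- As Γ has at least four elements, `L ─ z` is not empty; t will be the first vertex of
            -- a path t, v, and so on.
            other z with L ─ z in eq | ≤-trans (m≤m+n 2 l) (≤-trans (+-cancelˡ-≤ 2 _ _ m≤2+L) (length≤─ z uL))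
            ... | []    | s≤s ()
            ... | t ∷ _ | _ =
              let t∈ , t≢z = ∈-─⁻ {L} (subst (t ∈_) (sym eq) (here refl))
                  t∈₁ , t≢b = ∈-─⁻ t∈
                  t∈Γ , t≢a = ∈-─⁻ t∈₁
              in t , t∈Γ , t≢a , t≢b , t≢z
            -- A vertex y of L adjacent to a or b would continue t, v, y along the edge a b to a
            -- path on five vertices.
            leaves : ∀ {y z} → y ∈ L → y ~ z → z ≢ v → ⊥
            leaves {y} {z} y∈ y~z z≢v with z ≟ a | z ≟ b | other y | ∈-─⁻ y∈
            ... | no z≢a   | no z≢b   | _ | _ = far y∈ y~z z≢v z≢a z≢b
            ... | yes refl | _        | t , t∈Γ , t≢a , t≢b , t≢y | y∈₁ , y≢b =
              P₅-free l≡0 (~-sym (v~Γ t∈Γ)) (v~Γ (L⊑Γ y∈)) y~z a~b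
                (z≢v ∘ sym) (b≢v ∘ sym) (t≢a ∘ sym) t≢b t≢y (y≢b ∘ sym)
            ... | no _     | yes refl | t , t∈Γ , t≢a , t≢b , t≢y | y∈₁ , y≢b =
              P₅-free l≡0 (~-sym (v~Γ t∈Γ)) (v~Γ (L⊑Γ y∈)) y~z (~-sym a~b)
                (z≢v ∘ sym) (Γ≢v a∈Γ ∘ sym) (t≢b ∘ sym) t≢a t≢y (proj₂ (∈-─⁻ y∈₁) ∘ sym)
            -- If b is outside Γ, at least three leaves remain. If b is in Γ, then a and b see only
            -- v and each other; with two leaves they meet at most 2 + 2 + 2 = 6 edges, exactly the
            -- number in K_4.
            by-membership : Dec (b ∈ Γ) → Bounded U
            by-membership (no b∉Γ) = three-leaves uL L⊑Γ
              (≤-trans (≤-trans (m≤m+n 3 l) (+-cancelˡ-≤ 1 _ _ (≤-trans N≤m (length≤─ a uΓ))))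
                (≤-reflexive (cong length (sym (─-∉ (λ b∈ → b∉Γ (Γ─⊑Γ a b∈)))))))
              leaves
            by-membership (yes b∈Γ) = delete S {2 + (2 + length (take 2 L) * 1)} uS S⊑U (s≤s z≤n)
              (≤-trans (≤-reflexive (cong (2 +_) len)) (m≤m+n 4 l))
              (cost-∷ (b ∷ take 2 L) uU (Γ⊑U a∈Γ) (count≤length uU a-nbr)
                (cost-∷ (take 2 L) uU₁ (S⊑U₁ (here refl))
                  (≤-trans (degree-─ b uU (Γ⊑U a∈Γ)) (count≤length uU b-nbr))
                  (cost-degrees (take 2 L) (Unique-─ b uU₁) utake (⊑-─ ub S⊑U₁) low)))
              (subst (λ k → 2 * (2 + (2 + k * 1)) + (2 + k) ≤ (2 + k) * (2 + k)) (sym len) ≤-refl)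
              where
              S : List V
              S = a ∷ b ∷ take 2 L
              len : length (take 2 L) ≡ 2
              len = trans (length-take 2 L) (m≤n⇒m⊓n≡m (≤-trans (m≤m+n 2 l) (+-cancelˡ-≤ 2 _ _ m≤2+L)))
              utake : Unique (take 2 L)
              utake = Uniqueₚ.take⁺ 2 uL
              ub : Unique (b ∷ take 2 L)
              ub = All.tabulate (λ y∈ b≡y → proj₂ (∈-─⁻ (take-⊆ 2 L y∈)) (sym b≡y)) ∷ utake
              uS : Unique S
              uS = (a≢b ∷ All.tabulate (λ y∈ a≡y → proj₂ (∈-─⁻ (proj₁ (∈-─⁻ (take-⊆ 2 L y∈)))) (sym a≡y))) ∷ ub
              S⊑U : S ⊑ U
              S⊑U (here refl)         = Γ⊑U a∈Γ
              S⊑U (there (here refl)) = Γ⊑U b∈Γ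
              S⊑U (there (there y∈))  = Γ⊑U (L⊑Γ (take-⊆ 2 L y∈))
              uU₁ = Unique-─ a uU
              S⊑U₁ : (b ∷ take 2 L) ⊑ (U ─ a)
              S⊑U₁ = ⊑-─ uS S⊑U
              a-nbr : ∀ {z} → z ∈ U → a ~ z → z ∈ v ∷ b ∷ []
              a-nbr {z} _ a~z with z ≟ v | z ≟ b | other z
              ... | yes z≡v | _       | _ = here z≡v
              ... | no _    | yes z≡b | _ = there (here z≡b)
              ... | no z≢v  | no z≢b  | t , t∈Γ , t≢a , t≢b , t≢z =
                ⊥-elim (P₅-free l≡0 (~-sym (v~Γ t∈Γ)) (v~Γ b∈Γ) (~-sym a~b) a~z
                  (Γ≢v a∈Γ ∘ sym) (z≢v ∘ sym) (t≢a ∘ sym) t≢z t≢b z≢b)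
              b-nbr : ∀ {z} → z ∈ U → b ~ z → z ∈ v ∷ a ∷ []
              b-nbr {z} _ b~z with z ≟ v | z ≟ a | other z
              ... | yes z≡v | _       | _ = here z≡v
              ... | no _    | yes z≡a | _ = there (here z≡a)
              ... | no z≢v  | no z≢a  | t , t∈Γ , t≢a , t≢b , t≢z =
                ⊥-elim (P₅-free l≡0 (~-sym (v~Γ t∈Γ)) (v~Γ a∈Γ) a~b b~z
                  (b≢v ∘ sym) (z≢v ∘ sym) (t≢b ∘ sym) t≢z t≢a z≢a)
              low : ∀ {y} → y ∈ take 2 L → degree (U ─ a ─ b) y ≤ 1
              low {y} y∈ = ≤-trans (degree-─ y uU₁ (S⊑U₁ (here refl)))
                (≤-trans (degree-─ y uU (Γ⊑U a∈Γ)) (leaf (leaves (take-⊆ 2 L y∈))))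

        bounded-high : Bounded U
        -- The search for b covers the whole graph, not only U: `three-leaves` requires that v be
        -- the sole neighbour in G, and a forbidden tree may use vertices already deleted.
        bounded-high with search (λ a → any? (λ b → (a ~? b) ×-dec ¬? (b ≟ v)) (allFin p)) Γ
        ... | inj₂ none = three-leaves uΓ id (≤-trans (m≤m+n 3 (1 + l)) (≤-trans (≤-reflexive (+-suc 3 l)) N≤m)) leaves
          where
          leaves : ∀ {y z} → y ∈ Γ → y ~ z → z ≢ v → ⊥
          leaves y∈Γ y~z z≢v = none y∈Γ (lose (∈-allFin _) (y~z , z≢v))
        ... | inj₁ (a , a∈Γ , any-b) with find any-b | 1 ≤? l
        ...   | b , _ , a~b , b≢v | yes 1≤l = Edge.bounded-edge-long a∈Γ a~b b≢v 1≤l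
        ...   | b , _ , a~b , b≢v | no 1≰l  = Edge.bounded-edge-short a∈Γ a~b b≢v (n<1⇒n≡0 (≰⇒> 1≰l))

  module _ (U : List V) (uU : Unique U) (sparse : ∀ {x} → x ∈ U → degree U x ≤ 1 + l) where

    bounded-sparse : 4 + l ≤ length U → Bounded U
    bounded-sparse N≤ = 2 * length U , Deficit-sparse (4 + l) N≤ , (begin
      2 * edgesIn (adj G) U + 2 * length U
        ≡⟨ cong (_+ 2 * length U) (sym (handshake (Graph.sym G) (irrefl G) U)) ⟩
      sumOver (degree U) U + 2 * length U
        ≤⟨ +-monoˡ-≤ (2 * length U) (≤-trans (sumOver-mono U sparse) (≤-reflexive (sumOver-const (1 + l) U))) ⟩
      length U * (1 + l) + 2 * length U
        ≡⟨ collect (length U) l ⟩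
      (3 + l) * length U ∎)
      where
      open ≤-Reasoning
      collect : ∀ u l → u * (1 + l) + 2 * u ≡ (3 + l) * u
      collect = solve-∀

  bounded-step : ∀ U → Unique U → (∀ R → Unique R → length R < length U → Bounded R) → Bounded U
  bounded-step [] _ _ = 0 , Deficit-zero (4 + l) , z≤n
  bounded-step U@(_ ∷ _) uU rec = by-degree
    -- The thresholds are tried from the top, so that a vertex found at 3 + l or 2 + l has maximum
    -- degree.
    (search (λ v → 4 + l ≤? degree U v) U) (search (λ v → 3 + l ≤? degree U v) U) (search (λ v → 2 + l ≤? degree U v) U)
    where
    open Step U uU rec
    Found : ℕ → Set
    Found d = (∃[ v ] (v ∈ U × d ≤ degree U v)) ⊎ (∀ {v} → v ∈ U → ¬ d ≤ degree U v)
    middle : ∀ {d} v → v ∈ U → d ≡ 2 + l ⊎ d ≡ 3 + l → d ≤ degree U v → (∀ {x} → x ∈ U → ¬ suc d ≤ degree U x) → Bounded U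
    middle {d} v v∈U d≡ d≤ none = bounded-middle
      (≤-trans (2+l≤ d≡) (≤-trans d≤ (≤-reflexive degree≡))) (≤-trans (≤-reflexive (sym degree≡)) (≤-trans (top v∈U) (≤3+l d≡)))
      (λ x∈U → ≤-trans (top x∈U) (≤-trans d≤ (≤-reflexive degree≡)))
      where
      open Around v v∈U
      top : ∀ {x} → x ∈ U → degree U x ≤ d
      top x∈U = ≤-pred (≰⇒> (none x∈U))
      2+l≤ : d ≡ 2 + l ⊎ d ≡ 3 + l → 2 + l ≤ d
      2+l≤ (inj₁ refl) = ≤-refl
      2+l≤ (inj₂ refl) = n≤1+n _
      ≤3+l : d ≡ 2 + l ⊎ d ≡ 3 + l → d ≤ 3 + l
      ≤3+l (inj₁ refl) = n≤1+n _
      ≤3+l (inj₂ refl) = ≤-refl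
    by-degree : Found (4 + l) → Found (3 + l) → Found (2 + l) → Bounded U
    by-degree (inj₁ (v , v∈U , N≤)) _ _ =
      Around.High.bounded-high v v∈U (≤-trans N≤ (≤-reflexive (Around.degree≡ v v∈U)))
    by-degree (inj₂ none) (inj₁ (v , v∈U , d≤)) _ = middle v v∈U (inj₂ refl) d≤ none
    by-degree _ (inj₂ none) (inj₁ (v , v∈U , d≤)) = middle v v∈U (inj₁ refl) d≤ none
    by-degree _ _ (inj₂ none) with ≤-total (length U) (4 + l)
    -- At most N vertices: U is closed in itself and is deleted as a whole.
    ... | inj₁ small = delete-closed U uU id (s≤s z≤n) small (λ _ y∈U _ → y∈U)
    ... | inj₂ large = bounded-sparse U uU (λ x∈U → ≤-pred (≰⇒> (none x∈U))) large

  bounded-all : ∀ n U → length U ≤ n → Unique U → Bounded U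
  bounded-all zero    []  _      uU = bounded-step [] uU (λ _ _ ())
  bounded-all (suc n) U  U≤1+n uU = bounded-step U uU
    (λ R uR R<U → bounded-all n R (≤-pred (≤-trans R<U U≤1+n)) uR)

-- Constructions

<⇒<ᵇ≡true : ∀ {m n} → m < n → (m <ᵇ n) ≡ true
<⇒<ᵇ≡true m<n = Equivalence.to T-≡ (<⇒<ᵇ m<n)

≮⇒<ᵇ≡false : ∀ {m n} → n ≤ m → (m <ᵇ n) ≡ false
≮⇒<ᵇ≡false {m} {n} n≤m with m <ᵇ n in eq
... | false = refl
... | true  = contradiction (<ᵇ⇒< m n (Equivalence.from T-≡ eq)) (≤⇒≯ n≤m)

module _ {p} (A : Fin p → Fin p → Bool) where

  forwardEdges : List (Fin p) → ℕ
  forwardEdges xs = sumOver (λ i → count (λ j → (toℕ i <ᵇ toℕ j) ∧ A i j) xs) xs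

  -- In an increasing list the comparison of indices succeeds exactly at the later entries, so both
  -- sums count a pair at its earlier entry.
  forwardEdges≡edgesIn : ∀ xs → AllPairs (λ i j → toℕ i < toℕ j) xs → forwardEdges xs ≡ edgesIn A xs
  forwardEdges≡edgesIn [] _ = refl
  forwardEdges≡edgesIn (x ∷ xs) (x<xs ∷ sorted) = cong₂ _+_
    (trans (cong (λ b → bit (b ∧ A x x) + count (λ j → (toℕ x <ᵇ toℕ j) ∧ A x j) xs) (≮⇒<ᵇ≡false (≤-refl {toℕ x})))
      (sumOver-cong xs (λ {j} j∈ → cong (λ b → bit (b ∧ A x j)) (<⇒<ᵇ≡true (All.lookup x<xs j∈)))))
    (trans (sumOver-cong xs (λ {i} i∈ → cong (λ b → bit (b ∧ A i x) + count (λ j → (toℕ i <ᵇ toℕ j) ∧ A i j) xs)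
        (≮⇒<ᵇ≡false (<⇒≤ (All.lookup x<xs i∈)))))
      (forwardEdges≡edgesIn xs sorted))

edges≡edgesIn : ∀ {p} (G : Graph p) → edges G ≡ edgesIn (adj G) (allFin p)
edges≡edgesIn {p} G = forwardEdges≡edgesIn (adj G) (allFin p) (AllPairsₚ.tabulate⁺-< id)

module _ {V : Set} (A : V → V → Bool) where

  edgesIn-map : ∀ {W : Set} (f : W → V) xs → edgesIn A (map f xs) ≡ edgesIn (λ x y → A (f x) (f y)) xs
  edgesIn-map f []       = refl
  edgesIn-map f (x ∷ xs) = cong₂ _+_ (count-map xs) (edgesIn-map f xs)
    where
    count-map : ∀ ys → count (A (f x)) (map f ys) ≡ count (λ y → A (f x) (f y)) ys
    count-map []       = refl
    count-map (y ∷ ys) = cong (bit (A (f x) (f y)) +_) (count-map ys)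

  edgesIn-++ : ∀ xs ys → edgesIn A xs + edgesIn A ys ≤ edgesIn A (xs ++ ys)
  edgesIn-++ []       ys = ≤-refl
  edgesIn-++ (x ∷ xs) ys = ≤-trans (≤-reflexive (+-assoc (count (A x) xs) _ _))
    (+-mono-≤ (count-++ xs) (edgesIn-++ xs ys))
    where
    count-++ : ∀ zs → count (A x) zs ≤ count (A x) (zs ++ ys)
    count-++ []       = z≤n
    count-++ (z ∷ zs) = +-monoʳ-≤ (bit (A x z)) (count-++ zs)

  edgesIn-cong : ∀ {B} xs → (∀ x y → A x y ≡ B x y) → edgesIn A xs ≡ edgesIn B xs
  edgesIn-cong []       A≡B = refl
  edgesIn-cong (x ∷ xs) A≡B = cong₂ _+_ (sumOver-cong xs (λ {y} _ → cong bit (A≡B x y))) (edgesIn-cong xs A≡B)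

tabulate-++ : ∀ {V : Set} a {b} (f : Fin (a + b) → V) →
  tabulate f ≡ tabulate (f ∘ (_↑ˡ b)) ++ tabulate (f ∘ (a ↑ʳ_))
tabulate-++ zero    f = refl
tabulate-++ (suc a) f = cong (f zero ∷_) (tabulate-++ a (f ∘ suc))

-- Disjoint unions

module _ {a b} (G : Graph a) (H : Graph b) where

  unionAdj : Fin a ⊎ Fin b → Fin a ⊎ Fin b → Bool
  unionAdj (inj₁ x) (inj₁ y) = adj G x y
  unionAdj (inj₁ x) (inj₂ y) = false
  unionAdj (inj₂ x) (inj₁ y) = false
  unionAdj (inj₂ x) (inj₂ y) = adj H x y

  disjointUnion : Graph (a + b)
  disjointUnion = record
    { adj    = λ i j → unionAdj (splitAt a i) (splitAt a j)
    ; sym    = λ i j → unionAdj-sym (splitAt a i) (splitAt a j)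
    ; irrefl = λ i → unionAdj-irrefl (splitAt a i)
    }
    where
    unionAdj-sym : ∀ s t → unionAdj s t ≡ unionAdj t s
    unionAdj-sym (inj₁ x) (inj₁ y) = Graph.sym G x y
    unionAdj-sym (inj₁ x) (inj₂ y) = refl
    unionAdj-sym (inj₂ x) (inj₁ y) = refl
    unionAdj-sym (inj₂ x) (inj₂ y) = Graph.sym H x y
    unionAdj-irrefl : ∀ s → unionAdj s s ≡ false
    unionAdj-irrefl (inj₁ x) = irrefl G x
    unionAdj-irrefl (inj₂ x) = irrefl H x

  edges-disjointUnion : edges G + edges H ≤ edges disjointUnion
  edges-disjointUnion = begin
    edges G + edges H
      ≡⟨ cong₂ _+_ (trans (edges≡edgesIn G) left) (trans (edges≡edgesIn H) right) ⟩
    edgesIn K (tabulate (_↑ˡ b)) + edgesIn K (tabulate (a ↑ʳ_))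
      ≤⟨ edgesIn-++ K (tabulate (_↑ˡ b)) (tabulate (a ↑ʳ_)) ⟩
    edgesIn K (tabulate (_↑ˡ b) ++ tabulate (a ↑ʳ_))
      ≡⟨ cong (edgesIn K) (sym (tabulate-++ a id)) ⟩
    edgesIn K (allFin (a + b))
      ≡⟨ sym (edges≡edgesIn disjointUnion) ⟩
    edges disjointUnion ∎
    where
    open ≤-Reasoning
    K : Fin (a + b) → Fin (a + b) → Bool
    K = adj disjointUnion
    left : edgesIn (adj G) (allFin a) ≡ edgesIn K (tabulate (_↑ˡ b))
    left = trans
      (edgesIn-cong (adj G) (allFin a)
        (λ x y → sym (cong₂ unionAdj (splitAt-↑ˡ a x b) (splitAt-↑ˡ a y b))))
      (trans (sym (edgesIn-map K (_↑ˡ b) (allFin a))) (cong (edgesIn K) (map-tabulate id (_↑ˡ b))))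
    right : edgesIn (adj H) (allFin b) ≡ edgesIn K (tabulate (a ↑ʳ_))
    right = trans
      (edgesIn-cong (adj H) (allFin b)
        (λ x y → sym (cong₂ unionAdj (splitAt-↑ʳ a b x) (splitAt-↑ʳ a b y))))
      (trans (sym (edgesIn-map K (a ↑ʳ_) (allFin b))) (cong (edgesIn K) (map-tabulate id (a ↑ʳ_))))

-- One step from the centre reaches the positions up to n - 3, a second one the last two. It keeps a
-- copy of the tree on one side of a disjoint union.
T1-connected : ∀ {l} (P : Fin (5 + l) → Set) → (∀ {u v} → T1 (5 + l) u v → P u → P v) →
  P zero → ∀ i → P i
T1-connected {l} P step P0 i = by-position (m≤n⇒m<n∨m≡n (≤-pred (toℕ<n i)))
  where
  near : ∀ j → toℕ j ≤ 2 + l → P j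
  near zero    _  = P0
  near (suc j) j≤ = step (centre (s≤s z≤n) j≤) P0
  by-position : toℕ i < 4 + l ⊎ toℕ i ≡ 4 + l → P i
  by-position (inj₁ (s≤s i≤3+l)) with m≤n⇒m<n∨m≡n i≤3+l
  ... | inj₁ (s≤s i≤2+l) = near i i≤2+l
  ... | inj₂ i≡3+l = step (subst (T1Edgeℕ (5 + l) (toℕ u)) (sym i≡3+l)
                       (subst (λ u → T1Edgeℕ (5 + l) u (3 + l)) (sym toℕ-u) leftE))
                       (near u (≤-trans (≤-reflexive toℕ-u) (n≤1+n _)))
    where
    u<n : suc l < 5 + l
    u<n = m≤n+m (2 + l) 3
    u = fromℕ< u<n
    toℕ-u = toℕ-fromℕ< u<n
  by-position (inj₂ i≡4+l) = step (subst (T1Edgeℕ (5 + l) (toℕ u)) (sym i≡4+l)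
                       (subst (λ u → T1Edgeℕ (5 + l) u (4 + l)) (sym toℕ-u) rightE))
                       (near u (≤-reflexive toℕ-u))
    where
    u<n : 2 + l < 5 + l
    u<n = m≤n+m (3 + l) 2
    u = fromℕ< u<n
    toℕ-u = toℕ-fromℕ< u<n

Contains-disjointUnion : ∀ {a b l} (G : Graph a) (H : Graph b) →
  Contains (disjointUnion G H) (T1 (5 + l)) → Contains G (T1 (5 + l)) ⊎ Contains H (T1 (5 + l))
Contains-disjointUnion {a} {b} {l} G H (f , f-inj , f-adj) with splitAt a (f zero) in eq₀
... | inj₁ x₀ = inj₁ (proj₁ ∘ inLeft ,
    (λ {i} {j} eq → f-inj (trans (sym (proj₂ (inLeft i))) (trans (cong (_↑ˡ b) eq) (proj₂ (inLeft j))))) ,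
    (λ u v uv → trans (sym (cong₂ (unionAdj G H) (split (inLeft u)) (split (inLeft v)))) (f-adj u v uv)))
  where
  Left : Fin (5 + l) → Set
  Left i = ∃[ x ] (x ↑ˡ b ≡ f i)
  split : ∀ {i} → ((x , _) : Left i) → splitAt a (f i) ≡ inj₁ x
  split (x , eq) = trans (cong (splitAt a) (sym eq)) (splitAt-↑ˡ a x b)
  step : ∀ {u v} → T1 (5 + l) u v → Left u → Left v
  step {u} {v} uv left-u with splitAt a (f v) in eq | f-adj u v uv
  ... | inj₁ y | _ = y , splitAt⁻¹-↑ˡ eq
  ... | inj₂ y | uv≡true rewrite split left-u with () ← uv≡true
  inLeft : ∀ i → Left i
  inLeft = T1-connected Left step (x₀ , splitAt⁻¹-↑ˡ eq₀)
... | inj₂ x₀ = inj₂ (proj₁ ∘ inRight ,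
    (λ {i} {j} eq → f-inj (trans (sym (proj₂ (inRight i))) (trans (cong (a ↑ʳ_) eq) (proj₂ (inRight j))))) ,
    (λ u v uv → trans (sym (cong₂ (unionAdj G H) (split (inRight u)) (split (inRight v)))) (f-adj u v uv)))
  where
  Right : Fin (5 + l) → Set
  Right i = ∃[ x ] (a ↑ʳ x ≡ f i)
  split : ∀ {i} → ((x , _) : Right i) → splitAt a (f i) ≡ inj₂ x
  split (x , eq) = trans (cong (splitAt a) (sym eq)) (splitAt-↑ʳ a b x)
  step : ∀ {u v} → T1 (5 + l) u v → Right u → Right v
  step {u} {v} uv right-u with splitAt a (f v) in eq | f-adj u v uv
  ... | inj₂ y | _ = y , splitAt⁻¹-↑ʳ eq
  ... | inj₁ y | uv≡true rewrite split right-u with () ← uv≡true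
  inRight : ∀ i → Right i
  inRight = T1-connected Right step (x₀ , splitAt⁻¹-↑ʳ eq₀)

-- Complete graphs as blocks

complete : ∀ n → Graph n
complete n = record
  { adj    = λ i j → not (does (i ≟ j))
  ; sym    = distinct-sym
  ; irrefl = distinct-irrefl
  }
  where
  distinct-sym : ∀ (i j : Fin n) → not (does (i ≟ j)) ≡ not (does (j ≟ i))
  distinct-sym i j with i ≟ j | j ≟ i
  ... | yes _   | yes _   = refl
  ... | no _    | no _    = refl
  ... | yes i≡j | no j≢i  = contradiction (sym i≡j) j≢i
  ... | no i≢j  | yes j≡i = contradiction (sym j≡i) i≢j
  distinct-irrefl : ∀ (i : Fin n) → not (does (i ≟ i)) ≡ false
  distinct-irrefl i with i ≟ i
  ... | yes _  = refl
  ... | no i≢i = contradiction refl i≢i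

edges-complete : ∀ n → edges (complete n) ≡ triangular n
edges-complete n = trans (edges≡edgesIn (complete n))
  (trans (go (allFin n) (Uniqueₚ.allFin⁺ n)) (cong triangular (length-tabulate {n = n} (id {A = Fin n}))))
  where
  K = adj (complete n)
  distinct : ∀ {x y : Fin n} → x ≢ y → K x y ≡ true
  distinct {x} {y} x≢y with x ≟ y
  ... | yes x≡y = contradiction x≡y x≢y
  ... | no _    = refl
  go : ∀ xs → Unique xs → edgesIn K xs ≡ triangular (length xs)
  go []       _            = refl
  go (x ∷ xs) (x≢xs ∷ uxs) = cong₂ _+_
    (trans (sumOver-cong xs (λ y∈ → cong bit (distinct (All.lookup x≢xs y∈))))
      (trans (sumOver-const 1 xs) (*-identityʳ (length xs))))
    (go xs uxs)

FreeGraph : ℕ → ℕ → ℕ → Set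
FreeGraph l p e = Σ[ G ∈ Graph p ] (¬ Contains G (T1 (5 + l)) × e ≤ edges G)

free-small : ∀ {l p} → p < 5 + l → FreeGraph l p (triangular p)
free-small {l} {p} p<n = complete p , (λ (_ , f-inj , _) → <⇒≱ p<n (injective⇒≤ f-inj)) ,
  ≤-reflexive (sym (edges-complete p))

free-disjointUnion : ∀ {l p q d e} → FreeGraph l p d → FreeGraph l q e → FreeGraph l (p + q) (d + e)
free-disjointUnion (G , G-free , d≤) (H , H-free , e≤) = disjointUnion G H ,
  (λ T → [ G-free , H-free ]′ (Contains-disjointUnion G H T)) ,
  ≤-trans (+-mono-≤ d≤ e≤) (edges-disjointUnion G H)

free-blocks : ∀ {l p e} k → FreeGraph l p e → FreeGraph l (k * (4 + l) + p) (k * triangular (4 + l) + e)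
free-blocks zero    F = F
free-blocks {l} {p} {e} (suc k) F = subst₂ (FreeGraph l)
  (sym (+-assoc (4 + l) (k * (4 + l)) p))
  (sym (+-assoc (triangular (4 + l)) (k * triangular (4 + l)) e))
  (free-disjointUnion (free-small ≤-refl) (free-blocks k F))

-- The centre needs 2 + l neighbours; `g` lists the images of the positions 1 to 2 + l.
low-degree⇒free : ∀ {l p} (G : Graph p) → (∀ i → count (adj G i) (allFin p) ≤ 1 + l) → ¬ Contains G (T1 (5 + l))
low-degree⇒free {l} {p} G low (f , f-inj , f-adj) = <⇒≱ (s≤s (low (f zero))) (begin
  2 + l                                                    ≡⟨ sym (length-tabulate g) ⟩
  length (tabulate g)                                      ≤⟨ ⊆⇒length≤ (Uniqueₚ.tabulate⁺ g-inj) nbrs ⟩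
  length (filter (λ y → adj G (f zero) y Bool.≟ true) (allFin p)) ≡⟨ sym (count-filter (adj G (f zero)) (allFin p)) ⟩
  count (adj G (f zero)) (allFin p)                        ∎)
  where
  open ≤-Reasoning
  open Removal (_≟_ {p})
  g : Fin (2 + l) → Fin p
  g j = f (suc (inject₁ (inject₁ j)))
  g-inj : ∀ {i j} → g i ≡ g j → i ≡ j
  g-inj eq = inject₁-injective (inject₁-injective (Finₚ.suc-injective (f-inj eq)))
  nbrs : ∀ {y} → y ∈ tabulate g → y ∈ filter (λ y → adj G (f zero) y Bool.≟ true) (allFin p)
  nbrs y∈ with ∈-tabulate⁻ {f = g} y∈
  ... | j , refl = ∈-filter⁺ (λ y → adj G (f zero) y Bool.≟ true) (∈-allFin _) (f-adj zero _ (centre (s≤s z≤n)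
    (subst (_≤ 2 + l) (cong suc (sym (trans (toℕ-inject₁ (inject₁ j)) (toℕ-inject₁ j)))) (toℕ<n j))))

does-true : ∀ {P : Set} (P? : Dec P) → does P? ≡ true → P
does-true (yes p) _ = p

∧-true : ∀ x y → x ∧ y ≡ true → x ≡ true × y ≡ true
∧-true true true _ = refl , refl

-- Nearly regular circulant graphs

countUpTo : (ℕ → Bool) → ℕ → ℕ
countUpTo P zero    = 0
countUpTo P (suc n) = bit (P 0) + countUpTo (P ∘ suc) n

countUpTo-cong : ∀ {P R} n → (∀ j → j < n → P j ≡ R j) → countUpTo P n ≡ countUpTo R n
countUpTo-cong zero    P≡R = refl
countUpTo-cong (suc n) P≡R = cong₂ _+_ (cong bit (P≡R 0 (s≤s z≤n))) (countUpTo-cong n (λ j j<n → P≡R (suc j) (s≤s j<n)))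

countUpTo-+ : ∀ P m n → countUpTo P (m + n) ≡ countUpTo P m + countUpTo (λ j → P (m + j)) n
countUpTo-+ P zero    n = refl
countUpTo-+ P (suc m) n = trans (cong (bit (P 0) +_) (countUpTo-+ (P ∘ suc) m n)) (sym (+-assoc (bit (P 0)) _ _))

countUpTo-const : ∀ {P} b n → (∀ j → j < n → P j ≡ b) → countUpTo P n ≡ n * bit b
countUpTo-const b zero    P≡b = refl
countUpTo-const b (suc n) P≡b = cong₂ _+_ (cong bit (P≡b 0 (s≤s z≤n))) (countUpTo-const b n (λ j j<n → P≡b (suc j) (s≤s j<n)))

countUpTo-≤1 : ∀ {P} n → (∀ i j → P i ≡ true → P j ≡ true → i ≡ j) → countUpTo P n ≤ 1
countUpTo-≤1 zero uniq = z≤n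
countUpTo-≤1 {P} (suc n) uniq with P 0 in P0
... | false = countUpTo-≤1 n (λ i j Pi Pj → suc-injective (uniq _ _ Pi Pj))
... | true  = ≤-reflexive (cong suc (trans (countUpTo-const false n none) (*-zeroʳ n)))
  where
  none : ∀ j → j < n → P (suc j) ≡ false
  none j _ with P (suc j) in Psj
  ... | false = refl
  ... | true with () ← uniq 0 (suc j) P0 Psj

countUpTo-≥1 : ∀ {P} n {j} → j < n → P j ≡ true → 1 ≤ countUpTo P n
countUpTo-≥1 (suc n) {zero}  _         Pj rewrite Pj = s≤s z≤n
countUpTo-≥1 (suc n) {suc j} (s≤s j<n) Pj = ≤-trans (countUpTo-≥1 n j<n Pj) (m≤n+m _ _)

bit-∨ : ∀ x y → bit (x ∨ y) ≤ bit x + bit y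
bit-∨ true  y = s≤s z≤n
bit-∨ false y = ≤-refl

bit-∨-disjoint : ∀ x y → (y ≡ true → x ≡ false) → bit (x ∨ y) ≡ bit x + bit y
bit-∨-disjoint true  false _ = refl
bit-∨-disjoint true  true  d with () ← d refl
bit-∨-disjoint false y     _ = refl

countUpTo-∨ : ∀ P R n → countUpTo (λ j → P j ∨ R j) n ≤ countUpTo P n + countUpTo R n
countUpTo-∨ P R zero    = z≤n
countUpTo-∨ P R (suc n) = ≤-trans (+-mono-≤ (bit-∨ (P 0) (R 0)) (countUpTo-∨ (P ∘ suc) (R ∘ suc) n))
  (≤-reflexive (interchange (bit (P 0)) _ _ _))

countUpTo-∨-disjoint : ∀ P R n → (∀ j → R j ≡ true → P j ≡ false) →
  countUpTo (λ j → P j ∨ R j) n ≡ countUpTo P n + countUpTo R n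
countUpTo-∨-disjoint P R zero    d = refl
countUpTo-∨-disjoint P R (suc n) d = trans
  (cong₂ _+_ (bit-∨-disjoint (P 0) (R 0) (d 0)) (countUpTo-∨-disjoint (P ∘ suc) (R ∘ suc) n (λ j → d (suc j))))
  (interchange (bit (P 0)) _ _ _)

count-tabulate : ∀ {V : Set} {P : V → Bool} {R} n (f : Fin n → V) → (∀ i → P (f i) ≡ R (toℕ i)) →
  count P (tabulate f) ≡ countUpTo R n
count-tabulate zero    f P≡R = refl
count-tabulate (suc n) f P≡R = cong₂ _+_ (cong bit (P≡R zero)) (count-tabulate n (f ∘ suc) (P≡R ∘ suc))

-- Vertices at cyclic distance at most h are joined; if b holds, i is also joined to i + H for i < H.
module Circulant (h c H : ℕ) (b : Bool) (b≤c : bit b ≤ c)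
  (2H≤ : H + H ≤ 1 + (h + (c + h))) (≤2H : h + (c + h) ≤ H + H) where

  -- Once around the circle: a vertex, h neighbours, c vertices not joined by a chord, and h
  -- neighbours on the other side.
  M : ℕ
  M = 1 + (h + (c + h))

  short chord : ℕ → Bool
  short t = (0 <ᵇ t) ∧ (t <ᵇ suc h)
  chord t = short t ∨ short (M ∸ t)

  match matched : ℕ → ℕ → Bool
  match i j   = does ((i + H ℕ.≟ j) ×-dec (i <? H))
  matched i j = b ∧ (match i j ∨ match j i)

  short-true : ∀ {t} → 1 ≤ t → t ≤ h → short t ≡ true
  short-true {suc t} _ t≤h = <⇒<ᵇ≡true (s≤s t≤h)

  short-false : ∀ {t} → h < t → short t ≡ false
  short-false {t} h<t = trans (cong ((0 <ᵇ t) ∧_) (≮⇒<ᵇ≡false h<t)) (∧-zeroʳ _)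

  chord-sym : ∀ {t u} → t + u ≡ M → chord t ≡ chord u
  chord-sym {t} {u} t+u≡M = trans (∨-comm (short t) _)
    (cong₂ (λ x y → short x ∨ short y)
      (trans (cong (_∸ t) (sym t+u≡M)) (m+n∸m≡n t u))
      (sym (trans (cong (_∸ u) (sym t+u≡M)) (m+n∸n≡m t u))))

  chord-long : ∀ {t u} → t + u ≡ M → h < t → h < u → chord t ≡ false
  chord-long {t} {u} t+u≡M h<t h<u = cong₂ _∨_ (short-false h<t)
    (trans (cong short (trans (cong (_∸ t) (sym t+u≡M)) (m+n∸m≡n t u))) (short-false h<u))

  chord-0 : chord 0 ≡ false
  chord-0 = short-false (s≤s (m≤m+n h (c + h)))

  count-chord : countUpTo chord M ≡ h + h
  count-chord = begin
    bit (chord 0) + countUpTo (chord ∘ suc) (h + (c + h))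
      ≡⟨ cong₂ _+_ (cong bit chord-0) (countUpTo-+ (chord ∘ suc) h (c + h)) ⟩
    countUpTo (chord ∘ suc) h + countUpTo (λ j → chord (suc (h + j))) (c + h)
      ≡⟨ cong₂ _+_ (countUpTo-const true h low) (countUpTo-+ _ c h) ⟩
    h * 1 + (countUpTo (λ j → chord (suc (h + j))) c + countUpTo (λ j → chord (suc (h + (c + j)))) h)
      ≡⟨ cong₂ (λ x y → h * 1 + (x + y)) (countUpTo-const false c middle) (countUpTo-const true h high) ⟩
    h * 1 + (c * 0 + h * 1)
      ≡⟨ tidy h c ⟩
    h + h ∎
    where
    open ≡-Reasoning
    tidy : ∀ h c → h * 1 + (c * 0 + h * 1) ≡ h + h
    tidy = solve-∀
    low : ∀ j → j < h → chord (suc j) ≡ true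
    low j j<h = cong (_∨ short (M ∸ suc j)) (short-true (s≤s z≤n) j<h)
    middle : ∀ j → j < c → chord (suc (h + j)) ≡ false
    middle j j<c with m≤n⇒∃[o]m+o≡n j<c
    ... | o , refl = chord-long {u = suc (h + o)} (sum≡ h j o) (s≤s (m≤m+n h j)) (s≤s (m≤m+n h o))
      where
      sum≡ : ∀ h j o → suc (h + j) + suc (h + o) ≡ 1 + (h + (suc j + o + h))
      sum≡ = solve-∀
    high : ∀ j → j < h → chord (suc (h + (c + j))) ≡ true
    high j j<h with m≤n⇒∃[o]m+o≡n j<h
    ... | o , 1+j+o≡h = trans (chord-sym {suc (h + (c + j))} {suc o} (trans (sum≡ h c j o) (cong (λ x → 1 + (h + (c + x))) 1+j+o≡h)))
        (cong (_∨ short (M ∸ suc o)) (short-true (s≤s z≤n) (≤-trans (s≤s (m≤n+m o j)) (≤-reflexive 1+j+o≡h))))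
      where
      sum≡ : ∀ h c j o → suc (h + (c + j)) + suc o ≡ 1 + (h + (c + (suc j + o)))
      sum≡ = solve-∀

  -- Rotating the vertex i to 0 does not change its cyclic distances.
  count-distances : ∀ {i} → i < M → countUpTo (λ j → chord ∣ i - j ∣) M ≡ h + h
  count-distances {i} i<M with m≤n⇒∃[o]m+o≡n (<⇒≤ i<M)
  ... | s , i+s≡M = begin
    countUpTo (λ j → chord ∣ i - j ∣) M
      ≡⟨ cong (countUpTo _) (sym i+s≡M) ⟩
    countUpTo (λ j → chord ∣ i - j ∣) (i + s)
      ≡⟨ countUpTo-+ _ i s ⟩
    countUpTo (λ j → chord ∣ i - j ∣) i + countUpTo (λ j → chord ∣ i - i + j ∣) s
      ≡⟨ cong₂ _+_ (countUpTo-cong i before) (countUpTo-cong s (λ j _ → cong chord (∣m-m+n∣≡n i j))) ⟩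
    countUpTo (λ j → chord (s + j)) i + countUpTo chord s
      ≡⟨ +-comm _ (countUpTo chord s) ⟩
    countUpTo chord s + countUpTo (λ j → chord (s + j)) i
      ≡⟨ sym (countUpTo-+ chord s i) ⟩
    countUpTo chord (s + i)
      ≡⟨ cong (countUpTo chord) (trans (+-comm s i) i+s≡M) ⟩
    countUpTo chord M
      ≡⟨ count-chord ⟩
    h + h ∎
    where
    open ≡-Reasoning
    before : ∀ j → j < i → chord ∣ i - j ∣ ≡ chord (s + j)
    before j j<i with m≤n⇒∃[o]m+o≡n (<⇒≤ j<i)
    ... | u , refl = trans (cong chord (trans (∣-∣-comm (j + u) j) (∣m-m+n∣≡n j u)))
                       (chord-sym {u} {s + j} (trans (rotate u s j) i+s≡M))
      where
      rotate : ∀ u s j → u + (s + j) ≡ j + u + s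
      rotate = solve-∀

  -- With c ≥ 1 there is room between the chords: 2 h < 2 H. So a matching edge, of length H, is
  -- never a chord as well.
  1+h≤H : b ≡ true → 1 + h ≤ H
  1+h≤H b≡true = ≰⇒> (λ H≤h → <⇒≱ (+-monoʳ-< h (+-monoˡ-≤ h 1≤c)) (≤-trans ≤2H (+-mono-≤ H≤h H≤h)))
    where
    1≤c : 1 ≤ c
    1≤c = subst (λ b → bit b ≤ c) b≡true b≤c

  match-true : ∀ {i j} → match i j ≡ true → i + H ≡ j × i < H
  match-true {i} {j} = does-true ((i + H ℕ.≟ j) ×-dec (i <? H))

  true-match : ∀ {i j} → i + H ≡ j → i < H → match i j ≡ true
  true-match {i} {j} e i<H = dec-true ((i + H ℕ.≟ j) ×-dec (i <? H)) (e , i<H)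

  matched-true : ∀ i j → matched i j ≡ true → b ≡ true × ((i + H ≡ j × i < H) ⊎ (j + H ≡ i × j < H))
  matched-true i j ij = proj₁ split , either (match i j Bool.≟ true)
    where
    split : b ≡ true × (match i j ∨ match j i) ≡ true
    split = ∧-true b _ ij
    either : Dec (match i j ≡ true) → (i + H ≡ j × i < H) ⊎ (j + H ≡ i × j < H)
    either (yes m) = inj₁ (match-true {i} {j} m)
    either (no ¬m) = inj₂ (match-true {j} {i} (trans (cong (_∨ match j i) (sym (¬-not ¬m))) (proj₂ split)))

  matched-unique : ∀ i j k → matched i j ≡ true → matched i k ≡ true → j ≡ k
  matched-unique i j k ij ik with proj₂ (matched-true i j ij) | proj₂ (matched-true i k ik)
  ... | inj₁ (e , _)    | inj₁ (e′ , _)    = trans (sym e) e′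
  ... | inj₁ (_ , i<H)  | inj₂ (refl , _)  = contradiction i<H (≤⇒≯ (m≤n+m H k))
  ... | inj₂ (refl , _) | inj₁ (_ , i<H)   = contradiction i<H (≤⇒≯ (m≤n+m H j))
  ... | inj₂ (e , _)    | inj₂ (e′ , _)    = +-cancelʳ-≡ H j k (trans e (sym e′))

  matched-irrefl : ∀ i → matched i i ≡ false
  matched-irrefl i with matched i i in ii
  ... | false = refl
  ... | true with matched-true i i ii
  ...   | b≡true , p = contradiction (≤-trans (s≤s z≤n) (1+h≤H b≡true)) (λ 1≤H → <⇒≢ 1≤H (sym (H≡0 p)))
    where
    H≡0 : (i + H ≡ i × i < H) ⊎ (i + H ≡ i × i < H) → H ≡ 0
    H≡0 (inj₁ (e , _)) = +-cancelˡ-≡ i H 0 (trans e (sym (+-identityʳ i)))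
    H≡0 (inj₂ (e , _)) = +-cancelˡ-≡ i H 0 (trans e (sym (+-identityʳ i)))

  matched-disjoint : ∀ i j → matched i j ≡ true → chord ∣ i - j ∣ ≡ false
  matched-disjoint i j ij with matched-true i j ij
  ... | b≡true , p = trans (cong chord (dist p)) chord-H
    where
    dist : (i + H ≡ j × i < H) ⊎ (j + H ≡ i × j < H) → ∣ i - j ∣ ≡ H
    dist (inj₁ (refl , _)) = ∣m-m+n∣≡n i H
    dist (inj₂ (refl , _)) = trans (∣-∣-comm (j + H) j) (∣m-m+n∣≡n j H)
    chord-H : chord H ≡ false
    chord-H with m≤n⇒∃[o]m+o≡n 2H≤
    ... | o , 2H+o≡M = chord-long (trans (sym (+-assoc H H o)) 2H+o≡M) (1+h≤H b≡true) (≤-trans (1+h≤H b≡true) (m≤m+n H o))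

  count-matched : ∀ i → countUpTo (matched i) M ≤ bit b
  count-matched i = go b refl
    where
    go : ∀ b′ → b ≡ b′ → countUpTo (matched i) M ≤ bit b′
    go false b≡ = ≤-reflexive (trans (countUpTo-const false M (λ j _ → cong (_∧ (match i j ∨ match j i)) b≡)) (*-zeroʳ M))
    go true  _  = countUpTo-≤1 M (matched-unique i)

  -- The matching covers the vertices below 2 H: those below H have their partner H further on, the
  -- others H back.
  count-matched-low : ∀ i → bit (b ∧ (i <ᵇ H + H)) ≤ countUpTo (matched i) M
  count-matched-low i = go (b ∧ (i <ᵇ H + H)) refl
    where
    partner : b ≡ true → i < H + H → Dec (i < H) → 1 ≤ countUpTo (matched i) M
    partner b≡ i<2H (yes i<H) = countUpTo-≥1 {matched _} M (≤-trans (+-monoˡ-< H i<H) 2H≤)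
      (cong₂ (λ x y → x ∧ (y ∨ match (i + H) i)) b≡ (true-match {i} refl i<H))
    partner b≡ i<2H (no i≮H) with m≤n⇒∃[o]m+o≡n (≮⇒≥ i≮H)
    ... | j , refl = countUpTo-≥1 {matched _} M (≤-trans j<H (≤-trans (m≤m+n H H) 2H≤))
      (trans (cong₂ (λ x y → x ∧ (match (H + j) j ∨ y)) b≡ (true-match {j} (+-comm j H) j<H)) (∨-zeroʳ _))
      where
      j<H : j < H
      j<H = +-cancelˡ-< H j H i<2H
    go : ∀ x → b ∧ (i <ᵇ H + H) ≡ x → bit x ≤ countUpTo (matched i) M
    go false _ = z≤n
    go true  e = let b≡ , i< = ∧-true b _ e in
      partner b≡ (<ᵇ⇒< i (H + H) (Equivalence.from T-≡ i<)) (i <? H)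

  graph : Graph M
  graph = record
    { adj    = λ i j → chord ∣ toℕ i - toℕ j ∣ ∨ matched (toℕ i) (toℕ j)
    ; sym    = λ i j → cong₂ _∨_ (cong chord (∣-∣-comm (toℕ i) (toℕ j)))
                 (cong (b ∧_) (∨-comm (match (toℕ i) (toℕ j)) _))
    ; irrefl = λ i → cong₂ _∨_ (trans (cong chord (∣n-n∣≡0 (toℕ i))) chord-0) (matched-irrefl (toℕ i))
    }

  degree≡ : ∀ i → count (adj graph i) (allFin M) ≡ h + h + countUpTo (matched (toℕ i)) M
  degree≡ i = trans (count-tabulate {R = λ j → chord ∣ toℕ i - j ∣ ∨ matched (toℕ i) j} M id (λ _ → refl))
    (trans (countUpTo-∨-disjoint _ (matched (toℕ i)) M (matched-disjoint (toℕ i)))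
      (cong (_+ countUpTo (matched (toℕ i)) M) (count-distances (toℕ<n i))))

  degree≤ : ∀ i → count (adj graph i) (allFin M) ≤ h + h + bit b
  degree≤ i = ≤-trans (≤-reflexive (degree≡ i)) (+-monoʳ-≤ (h + h) (count-matched (toℕ i)))

  edges≥ : M * (h + h) + (H + H) * bit b ≤ 2 * edges graph
  edges≥ = begin
    M * (h + h) + (H + H) * bit b
      ≡⟨ cong₂ _+_ (sym (trans (sumOver-const (h + h) (allFin M)) (cong (_* (h + h)) (length-tabulate {n = M} (id {A = Fin M})))))
           (sym count-low) ⟩
    sumOver (λ _ → h + h) (allFin M) + count (λ i → b ∧ (toℕ i <ᵇ H + H)) (allFin M)
      ≡⟨ sym (sumOver-+ (λ _ → h + h) (λ i → bit (b ∧ (toℕ i <ᵇ H + H))) (allFin M)) ⟩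
    sumOver (λ i → h + h + bit (b ∧ (toℕ i <ᵇ H + H))) (allFin M)
      ≤⟨ sumOver-mono (allFin M) (λ {i} _ → ≤-trans (+-monoʳ-≤ (h + h) (count-matched-low (toℕ i)))
           (≤-reflexive (sym (degree≡ i)))) ⟩
    sumOver (λ i → count (adj graph i) (allFin M)) (allFin M)
      ≡⟨ handshake (Graph.sym graph) (irrefl graph) (allFin M) ⟩
    2 * edgesIn (adj graph) (allFin M)
      ≡⟨ cong (2 *_) (sym (edges≡edgesIn graph)) ⟩
    2 * edges graph ∎
    where
    open ≤-Reasoning
    count-low : count (λ i → b ∧ (toℕ i <ᵇ H + H)) (allFin M) ≡ (H + H) * bit b
    count-low with m≤n⇒∃[o]m+o≡n 2H≤
    ... | o , 2H+o≡M = trans (count-tabulate {R = λ i → b ∧ (i <ᵇ H + H)} M id (λ _ → refl))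
      (trans (cong (countUpTo _) (sym 2H+o≡M))
        (trans (countUpTo-+ (λ i → b ∧ (i <ᵇ H + H)) (H + H) o)
          (trans (cong₂ _+_
            (countUpTo-const b (H + H) (λ j j< → trans (cong (b ∧_) (<⇒<ᵇ≡true j<)) (∧-identityʳ b)))
            (trans (countUpTo-const false o (λ j _ → trans (cong (b ∧_) (≮⇒<ᵇ≡false (m≤m+n (H + H) j))) (∧-zeroʳ b))) (*-zeroʳ o)))
            (+-identityʳ _))))

parity : ∀ n → ∃[ h ] ∃[ b ] n ≡ h + h + bit b
parity zero = 0 , false , refl
parity (suc n) with parity n
... | h , false , refl = h , true , sym (+-suc (h + h) 0)
... | h , true  , refl = suc h , false , carry h
  where
  carry : ∀ h → suc (h + h + 1) ≡ suc h + suc h + 0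
  carry = solve-∀

-- The degree aimed at is 1 + l = N - 3; if it is odd, the matching supplies the last neighbour. The
-- choice c = 2 + bit b + r gives M = N + r vertices. At most one vertex stays unmatched, when M is
-- odd, which accounts for the 1 on the right.
free-circulant : ∀ l r → ∃[ e ] (FreeGraph l (4 + l + r) e × (1 + l) * (4 + l + r) ≤ 2 * e + 1)
free-circulant l r with parity (1 + l)
... | h , b , 1+l≡ with parity (1 + (h + (2 + bit b + r + h)))
...   | H , b′ , M≡ = edges graph ,
    subst (λ p → FreeGraph l p (edges graph)) M≡4+l+r
      (graph , low-degree⇒free graph (λ i → ≤-trans (degree≤ i) (≤-reflexive (sym 1+l≡))) , ≤-refl) ,
    (begin
      (1 + l) * (4 + l + r)                       ≡⟨ cong₂ _*_ 1+l≡ (sym M≡4+l+r) ⟩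
      (h + h + bit b) * M                         ≡⟨ split h (bit b) M ⟩
      M * (h + h) + M * bit b                     ≤⟨ +-monoʳ-≤ (M * (h + h)) (*-monoˡ-≤ (bit b) M≤) ⟩
      M * (h + h) + (H + H + 1) * bit b           ≡⟨ regroup (M * (h + h)) (H + H) (bit b) ⟩
      M * (h + h) + (H + H) * bit b + bit b       ≤⟨ +-mono-≤ edges≥ (bit≤1 b) ⟩
      2 * edges graph + 1                         ∎)
  where
  open ≤-Reasoning
  M≤ : 1 + (h + (2 + bit b + r + h)) ≤ H + H + 1
  M≤ = ≤-trans (≤-reflexive M≡) (+-monoʳ-≤ (H + H) (bit≤1 b′))
  open Circulant h (2 + bit b + r) H b (≤-trans (m≤m+n (bit b) r) (≤-trans (n≤1+n _) (n≤1+n _)))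
    (≤-trans (m≤m+n (H + H) (bit b′)) (≤-reflexive (sym M≡)))
    (+-cancelʳ-≤ 1 _ _ (≤-trans (≤-reflexive (+-comm _ 1)) M≤))
  M≡4+l+r : M ≡ 4 + l + r
  M≡4+l+r = trans (collect h (bit b) r) (cong (λ d → 3 + d + r) (sym 1+l≡))
    where
    collect : ∀ h x r → 1 + (h + (2 + x + r + h)) ≡ 3 + (h + h + x) + r
    collect = solve-∀
  split : ∀ h x M → (h + h + x) * M ≡ M * (h + h) + M * x
  split = solve-∀
  regroup : ∀ y z x → y + (z + 1) * x ≡ y + z * x + x
  regroup = solve-∀

-- Comparing the two candidate values

half-lower : ∀ {x y} → 2 * x ≤ y → x ≤ ⌊ y /2⌋
half-lower {x} {y} 2x≤y = begin
  x               ≡⟨ n≡⌊n+n/2⌋ x ⟩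
  ⌊ x + x /2⌋     ≤⟨ ⌊n/2⌋-mono (≤-trans (≤-reflexive (cong (x +_) (sym (+-identityʳ x)))) 2x≤y) ⟩
  ⌊ y /2⌋         ∎
  where open ≤-Reasoning

half-upper : ∀ {x y} → y ≤ 2 * x + 1 → ⌊ y /2⌋ ≤ x
half-upper {x} {y} y≤ = begin
  ⌊ y /2⌋             ≤⟨ ⌊n/2⌋-mono (≤-trans y≤ (≤-reflexive (odd x))) ⟩
  ⌊ suc (x + x) /2⌋   ≡⟨ sym (n≡⌈n+n/2⌉ x) ⟩
  x                   ∎
  where
  open ≤-Reasoning
  odd : ∀ x → 2 * x + 1 ≡ suc (x + x)
  odd = solve-∀

2*half≤ : ∀ y → 2 * ⌊ y /2⌋ ≤ y
2*half≤ y = begin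
  2 * ⌊ y /2⌋              ≡⟨ cong (⌊ y /2⌋ +_) (+-identityʳ ⌊ y /2⌋) ⟩
  ⌊ y /2⌋ + ⌊ y /2⌋        ≤⟨ +-monoʳ-≤ ⌊ y /2⌋ (⌊n/2⌋≤⌈n/2⌉ y) ⟩
  ⌊ y /2⌋ + ⌈ y /2⌉        ≡⟨ ⌊n/2⌋+⌈n/2⌉≡n y ⟩
  y                        ∎
  where open ≤-Reasoning

≤2*half+1 : ∀ y → y ≤ 2 * ⌊ y /2⌋ + 1
≤2*half+1 zero          = z≤n
≤2*half+1 (suc zero)    = ≤-refl
≤2*half+1 (suc (suc y)) = ≤-trans (s≤s (s≤s (≤2*half+1 y))) (≤-reflexive (sym (step ⌊ y /2⌋)))
  where
  step : ∀ h → 2 * suc h + 1 ≡ 2 + (2 * h + 1)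
  step = solve-∀

half-≤-half : ∀ X w M → 2 * M ≤ w → ⌊ X ∸ w /2⌋ ≤ ⌊ X /2⌋ ∸ M
half-≤-half X w M 2M≤w with ≤-total w X
... | inj₂ X≤w rewrite m≤n⇒m∸n≡0 X≤w = z≤n
... | inj₁ w≤X = m+n≤o⇒m≤o∸n ⌊ X ∸ w /2⌋ (half-lower (begin
  2 * (⌊ X ∸ w /2⌋ + M)           ≡⟨ *-distribˡ-+ 2 ⌊ X ∸ w /2⌋ M ⟩
  2 * ⌊ X ∸ w /2⌋ + 2 * M         ≤⟨ +-mono-≤ (2*half≤ (X ∸ w)) 2M≤w ⟩
  X ∸ w + w                       ≡⟨ m∸n+n≡m w≤X ⟩
  X                               ∎))
  where open ≤-Reasoning

half-≥-half : ∀ X w M → w ≤ 2 * M → ⌊ X /2⌋ ∸ M ≤ ⌊ X ∸ w /2⌋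
half-≥-half X w M w≤2M = m≤n+o⇒m∸n≤o ⌊ X /2⌋ M (half-upper (begin
  X                                   ≤⟨ m≤n+m∸n X w ⟩
  w + (X ∸ w)                         ≤⟨ +-mono-≤ w≤2M (≤2*half+1 (X ∸ w)) ⟩
  2 * M + (2 * ⌊ X ∸ w /2⌋ + 1)       ≡⟨ collect M ⌊ X ∸ w /2⌋ ⟩
  2 * (M + ⌊ X ∸ w /2⌋) + 1           ∎))
  where
  open ≤-Reasoning
  collect : ∀ M h → 2 * M + (2 * h + 1) ≡ 2 * (M + h) + 1
  collect = solve-∀

-- With r = 3 + a and n − 1 − r = 5 + b, the inequality r (n−1−r) ≥ 2 (n−1+r) reads (a+1)(b+1) ≥ 8.
excess : ∀ a b → 7 ≤ a + b + a * b → 2 * ((3 + a) + (5 + b) + (3 + a)) ≤ (3 + a) * (5 + b)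
excess a b 7≤ = begin
  2 * ((3 + a) + (5 + b) + (3 + a))           ≡⟨ left a b ⟩
  7 + (15 + 4 * a + 2 * b)                    ≤⟨ +-monoˡ-≤ _ 7≤ ⟩
  a + b + a * b + (15 + 4 * a + 2 * b)        ≡⟨ right a b ⟩
  (3 + a) * (5 + b)                           ∎
  where
  open ≤-Reasoning
  left : ∀ a b → 2 * ((3 + a) + (5 + b) + (3 + a)) ≡ 7 + (15 + 4 * a + 2 * b)
  left = solve-∀
  right : ∀ a b → a + b + a * b + (15 + 4 * a + 2 * b) ≡ (3 + a) * (5 + b)
  right = solve-∀

shortfall : ∀ a b → a + b + a * b ≤ 7 → (3 + a) * (5 + b) ≤ 2 * ((3 + a) + (5 + b) + (3 + a))
shortfall a b ≤7 = begin
  (3 + a) * (5 + b)                           ≡⟨ right a b ⟩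
  a + b + a * b + (15 + 4 * a + 2 * b)        ≤⟨ +-monoˡ-≤ _ ≤7 ⟩
  7 + (15 + 4 * a + 2 * b)                    ≡⟨ left a b ⟩
  2 * ((3 + a) + (5 + b) + (3 + a))           ∎
  where
  open ≤-Reasoning
  left : ∀ a b → 7 + (15 + 4 * a + 2 * b) ≡ 2 * ((3 + a) + (5 + b) + (3 + a))
  left = solve-∀
  right : ∀ a b → (3 + a) * (5 + b) ≡ a + b + a * b + (15 + 4 * a + 2 * b)
  right = solve-∀

-- Put a = r - 3 and b = r′ - 5, so a + b = n - 9. In the first range a + b ≥ 7 suffices. In the
-- second both are at least 1 and a + b ≥ 4, whence (a+1)(b+1) ≥ 8. There the code shifts a and b
-- down by one.
CaseA⇒excess : ∀ r r′ → CaseA (1 + (r + r′)) r → 2 * (r + r′ + r) ≤ r * r′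
CaseA⇒excess r r′ (inj₁ (16≤n , 3≤r , r≤n∸6)) = narrow (m≤n⇒∃[o]m+o≡n 3≤r) (m≤n⇒∃[o]m+o≡n 5≤r′)
  where
  5≤r′ : 5 ≤ r′
  5≤r′ = +-cancelˡ-≤ r _ _ (≤-pred (≤-trans (≤-reflexive (sym (+-suc r 5)))
    (≤-trans (+-monoˡ-≤ 6 r≤n∸6) (≤-reflexive (m∸n+n≡m (≤-trans (m≤m+n 6 10) 16≤n))))))
  narrow : (∃[ a ] 3 + a ≡ r) → (∃[ b ] 5 + b ≡ r′) → 2 * (r + r′ + r) ≤ r * r′
  narrow (a , refl) (b , refl) = excess a b (≤-trans 7≤a+b (m≤m+n (a + b) (a * b)))
    where
    n≡ : ∀ a b → 1 + (3 + a + (5 + b)) ≡ 9 + (a + b)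
    n≡ = solve-∀
    7≤a+b : 7 ≤ a + b
    7≤a+b = +-cancelˡ-≤ 9 _ _ (≤-trans 16≤n (≤-reflexive (n≡ a b)))
CaseA⇒excess r r′ (inj₂ (13≤n , _ , 4≤r , r≤n∸7)) = narrow (m≤n⇒∃[o]m+o≡n 4≤r) (m≤n⇒∃[o]m+o≡n 6≤r′)
  where
  6≤r′ : 6 ≤ r′
  6≤r′ = +-cancelˡ-≤ r _ _ (≤-pred (≤-trans (≤-reflexive (sym (+-suc r 6)))
    (≤-trans (+-monoˡ-≤ 7 r≤n∸7) (≤-reflexive (m∸n+n≡m (≤-trans (m≤m+n 7 6) 13≤n))))))
  narrow : (∃[ a ] 4 + a ≡ r) → (∃[ b ] 6 + b ≡ r′) → 2 * (r + r′ + r) ≤ r * r′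
  narrow (a , refl) (b , refl) = excess (suc a) (suc b) (begin
    7                                        ≤⟨ +-monoʳ-≤ 3 (*-monoʳ-≤ 2 2≤a+b) ⟩
    3 + 2 * (a + b)                          ≤⟨ m≤m+n _ (a * b) ⟩
    3 + 2 * (a + b) + a * b                  ≡⟨ expand a b ⟩
    suc a + suc b + suc a * suc b            ∎)
    where
    open ≤-Reasoning
    n≡ : ∀ a b → 1 + (4 + a + (6 + b)) ≡ 11 + (a + b)
    n≡ = solve-∀
    2≤a+b : 2 ≤ a + b
    2≤a+b = +-cancelˡ-≤ 11 _ _ (≤-trans 13≤n (≤-reflexive (n≡ a b)))
    expand : ∀ a b → 3 + 2 * (a + b) + a * b ≡ suc a + suc b + suc a * suc b
    expand = solve-∀

-- The product is small at once if r ≤ 2 or r′ ≤ 4. Otherwise, with a and b as above, a + b ≤ 6,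
-- which is enough if one of them is 0. If both are positive, being outside the second range forces
-- n ≤ 12, hence a + b ≤ 3.
¬CaseA⇒shortfall : ∀ r r′ → ¬ CaseA (1 + (r + r′)) r → r * r′ ≤ 2 * (r + r′ + r)
¬CaseA⇒shortfall r r′ ¬A with 3 ≤? r | 5 ≤? r′
... | no 3≰r | _ = ≤-trans (*-monoˡ-≤ r′ (≤-pred (≰⇒> 3≰r)))
        (*-monoʳ-≤ 2 (≤-trans (m≤n+m r′ r) (m≤m+n (r + r′) r)))
... | yes _  | no 5≰r′ = ≤-trans (*-monoʳ-≤ r (≤-pred (≰⇒> 5≰r′)))
        (≤-trans (≤-reflexive (regroup r)) (*-monoʳ-≤ 2 (+-monoˡ-≤ r (m≤m+n r r′))))
  where
  regroup : ∀ r → r * 4 ≡ 2 * (r + r)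
  regroup = solve-∀
... | yes 3≤r | yes 5≤r′ with m≤n⇒∃[o]m+o≡n 3≤r | m≤n⇒∃[o]m+o≡n 5≤r′
...   | a , refl | b , refl with 7 ≤? a + b
...     | yes 7≤a+b = contradiction (inj₁ (16≤n , s≤s (s≤s (s≤s z≤n)) , r≤)) ¬A
  where
  n≡ : ∀ a b → 9 + (a + b) ≡ 1 + (3 + a + (5 + b))
  n≡ = solve-∀
  16≤n : 16 ≤ 1 + (3 + a + (5 + b))
  16≤n = ≤-trans (+-monoʳ-≤ 9 7≤a+b) (≤-reflexive (n≡ a b))
  r≤ : 3 + a ≤ 1 + (3 + a + (5 + b)) ∸ 6
  r≤ = ≤-trans (+-monoʳ-≤ 3 (m≤m+n a b)) (≤-reflexive (cong (_∸ 6) (n≡ a b)))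
...     | no 7≰a+b = shortfall a b (small a b ¬A (≤-pred (≰⇒> 7≰a+b)))
  where
  small : ∀ a b → ¬ CaseA (1 + (3 + a + (5 + b))) (3 + a) → a + b ≤ 6 → a + b + a * b ≤ 7
  small zero    b       ¬A ≤6 = ≤-trans (≤-reflexive (+-identityʳ b)) (≤-trans ≤6 (n≤1+n 6))
  small (suc a) zero    ¬A ≤6 = ≤-trans (≤-reflexive (trans (cong (suc a + 0 +_) (*-zeroʳ a)) (+-identityʳ _))) (≤-trans ≤6 (n≤1+n 6))
  small (suc a) (suc b) ¬A ≤6 = by-sum (2 ≤? a + b)
    where
    n≡ : ∀ a b → 11 + (a + b) ≡ 1 + (3 + suc a + (5 + suc b))
    n≡ = solve-∀
    n≡′ : ∀ a b → 1 + (3 + suc a + (5 + suc b)) ≡ 9 + (suc a + suc b)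
    n≡′ = solve-∀
    tiny : ∀ a b → a + b ≤ 1 → suc a + suc b + suc a * suc b ≤ 7
    tiny zero       zero       _       = m≤m+n 3 4
    tiny zero       (suc zero) _       = m≤m+n 5 2
    tiny (suc zero) zero       _       = m≤m+n 5 2
    tiny zero          (suc (suc b)) (s≤s ())
    tiny (suc zero)    (suc b)       (s≤s ())
    tiny (suc (suc a)) b             (s≤s ())
    by-sum : Dec (2 ≤ a + b) → suc a + suc b + suc a * suc b ≤ 7
    by-sum (no 2≰a+b)  = tiny a b (≤-pred (≰⇒> 2≰a+b))
    by-sum (yes 2≤a+b) = contradiction (inj₂
      ( ≤-trans (+-monoʳ-≤ 11 2≤a+b) (≤-reflexive (n≡ a b))
      , ≤-trans (≤-reflexive (n≡′ a b)) (+-monoʳ-≤ 9 ≤6)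
      , s≤s (s≤s (s≤s (s≤s z≤n)))
      , ≤-trans (+-monoʳ-≤ 4 (m≤m+n a b)) (≤-reflexive (cong (_∸ 7) (n≡ a b))))) ¬A

-- Both bounds combined

module Extremal (l k r r′ : ℕ) (r+r′≡N : r + r′ ≡ 4 + l) (r<N : r < 4 + l) where

  p X candidateA candidateB : ℕ
  p = suc k * (4 + l) + r
  X = (3 + l) * p
  candidateA = ⌊ X /2⌋ ∸ (4 + l + r)
  candidateB = ⌊ X ∸ r * r′ /2⌋

  -- All but one of the k + 1 blocks stay complete; the last block and the remainder together carry
  -- the circulant graph on N + r vertices.
  lowerA : FreeGraph l p candidateA
  lowerA =
    let e , F , large = free-circulant l r
        G , G-free , E≤ = subst (λ q → FreeGraph l q (k * triangular (4 + l) + e)) p≡ (free-blocks k F)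
    in G , G-free , ≤-trans (m≤n+o⇒m∸n≤o ⌊ X /2⌋ (4 + l + r) (half-upper {y = X} (X≤ e large))) E≤
    where
    open ≤-Reasoning
    p≡ : k * (4 + l) + (4 + l + r) ≡ p
    p≡ = rotate (k * (4 + l)) (4 + l) r
      where
      rotate : ∀ x N r → x + (N + r) ≡ N + x + r
      rotate = solve-∀
    expand : ∀ k l r → k * (4 + l) + (3 + l) * (suc k * (4 + l) + r) ≡
      k * ((4 + l) * (4 + l)) + (1 + l) * (4 + l + r) + 2 * (4 + l + r)
    expand = solve-∀
    collect : ∀ k t N e M → k * (2 * t + N) + (2 * e + 1) + 2 * M ≡ k * N + (2 * (M + (k * t + e)) + 1)
    collect = solve-∀
    X≤ : ∀ e → (1 + l) * (4 + l + r) ≤ 2 * e + 1 → X ≤ 2 * ((4 + l + r) + (k * triangular (4 + l) + e)) + 1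
    X≤ e large = +-cancelˡ-≤ (k * (4 + l)) _ _ (begin
      k * (4 + l) + X
        ≡⟨ expand k l r ⟩
      k * ((4 + l) * (4 + l)) + (1 + l) * (4 + l + r) + 2 * (4 + l + r)
        ≤⟨ +-monoˡ-≤ (2 * (4 + l + r)) (+-monoʳ-≤ (k * ((4 + l) * (4 + l))) large) ⟩
      k * ((4 + l) * (4 + l)) + (2 * e + 1) + 2 * (4 + l + r)
        ≡⟨ cong (λ s → k * s + (2 * e + 1) + 2 * (4 + l + r)) (sym (2*triangular (4 + l))) ⟩
      k * (2 * triangular (4 + l) + (4 + l)) + (2 * e + 1) + 2 * (4 + l + r)
        ≡⟨ collect k (triangular (4 + l)) (4 + l) e (4 + l + r) ⟩
      k * (4 + l) + (2 * ((4 + l + r) + (k * triangular (4 + l) + e)) + 1)   ∎)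

  lowerB : FreeGraph l p candidateB
  lowerB =
    let G , G-free , E≤ = free-blocks (suc k) (free-small (≤-trans r<N (n≤1+n (4 + l))))
    in G , G-free , ≤-trans
      (half-upper {y = X ∸ r * r′} (≤-trans (m≤n+o⇒m∸n≤o X (r * r′) X≤) (m≤m+n (2 * E) 1))) E≤
    where
    open ≤-Reasoning
    E : ℕ
    E = suc k * triangular (4 + l) + triangular r
    X≤ : X ≤ r * r′ + 2 * E
    X≤ = +-cancelˡ-≤ p _ _ (begin
      p + (3 + l) * p                                       ≡⟨⟩
      (4 + l) * p                                           ≡⟨ expand (suc k) (4 + l) r ⟩
      suc k * ((4 + l) * (4 + l)) + r * (4 + l)             ≡⟨ cong₂ (λ s t → suc k * s + r * t) (sym (2*triangular (4 + l))) (sym r+r′≡N) ⟩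
      suc k * (2 * triangular (4 + l) + (4 + l)) + r * (r + r′)
        ≡⟨ cong (suc k * (2 * triangular (4 + l) + (4 + l)) +_) (trans (*-distribˡ-+ r r r′) (cong (_+ r * r′) (sym (2*triangular r)))) ⟩
      suc k * (2 * triangular (4 + l) + (4 + l)) + (2 * triangular r + r + r * r′)
        ≡⟨ collect (suc k) (triangular (4 + l)) (4 + l) (triangular r) r (r * r′) ⟩
      p + (r * r′ + 2 * E)                                  ∎)
      where
      expand : ∀ K N r → N * (K * N + r) ≡ K * (N * N) + r * N
      expand = solve-∀
      collect : ∀ K t N s r w → K * (2 * t + N) + (2 * s + r + w) ≡ K * N + r + (w + 2 * (K * t + s))
      collect = solve-∀

  upper : ∀ (G : Graph p) → ¬ Contains G (T1 (5 + l)) → edges G ≤ candidateA ⊎ edges G ≤ candidateB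
  upper G G-free with subst₂ (EdgeBound (3 + l)) (sym (edges≡edgesIn G)) (length-tabulate {n = p} (id {A = Fin p}))
                        (UpperBound.bounded-all l G G-free p (allFin p) (≤-reflexive (length-tabulate {n = p} (id {A = Fin p}))) (Uniqueₚ.allFin⁺ p))
  ... | d , D , 2e+d≤X with Deficit-unique (4 + l) {k = suc k} r<N r+r′≡N D
  ...   | inj₁ w≤d = inj₂ (half-lower (m+n≤o⇒m≤o∸n (2 * edges G) (≤-trans (+-monoʳ-≤ (2 * edges G) w≤d) 2e+d≤X)))
  ...   | inj₂ 2M≤d = inj₁ (m+n≤o⇒m≤o∸n (edges G) (half-lower
            (≤-trans (≤-reflexive (*-distribˡ-+ 2 (edges G) (4 + l + r))) (≤-trans (+-monoʳ-≤ (2 * edges G) 2M≤d) 2e+d≤X))))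

  -- The upper bound leaves open which candidate applies, so an attained value is extremal once it
  -- dominates both.
  isEx : ∀ m → FreeGraph l p m → candidateA ≤ m → candidateB ≤ m → IsEx p (T1 (5 + l)) m
  isEx m (G , G-free , m≤) A≤m B≤m = (G , G-free , ≤-antisym (bound G G-free) m≤) , bound
    where
    bound : ∀ (G : Graph p) → ¬ Contains G (T1 (5 + l)) → edges G ≤ m
    bound G G-free = [ (λ e≤A → ≤-trans e≤A A≤m) , (λ e≤B → ≤-trans e≤B B≤m) ]′ (upper G G-free)

  extremal : IsEx p (T1 (5 + l)) (candidateA ⊔ candidateB)
    × (CaseA (5 + l) r → IsEx p (T1 (5 + l)) candidateA)
    × (¬ CaseA (5 + l) r → IsEx p (T1 (5 + l)) candidateB)
  extremal = isEx (candidateA ⊔ candidateB) lower-⊔ (m≤m⊔n candidateA candidateB) (m≤n⊔m candidateA candidateB) ,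
    (λ caseA → isEx candidateA lowerA ≤-refl
      (half-≤-half X (r * r′) (4 + l + r) (subst (λ N → 2 * (N + r) ≤ r * r′) r+r′≡N
          (CaseA⇒excess r r′ (subst (λ N → CaseA (1 + N) r) (sym r+r′≡N) caseA))))) ,
    (λ ¬caseA → isEx candidateB lowerB
      (half-≥-half X (r * r′) (4 + l + r)
        (subst (λ N → r * r′ ≤ 2 * (N + r)) r+r′≡N
          (¬CaseA⇒shortfall r r′ (subst (λ N → ¬ CaseA (1 + N) r) (sym r+r′≡N) ¬caseA)))) ≤-refl)
    where
    lower-⊔ : FreeGraph l p (candidateA ⊔ candidateB)
    lower-⊔ with ⊔-sel candidateA candidateB
    ... | inj₁ eq = subst (FreeGraph l p) (sym eq) lowerA
    ... | inj₂ eq = subst (FreeGraph l p) (sym eq) lowerB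

theorem2p1 : ∀ (p n k r : ℕ) → n ∸ 1 ≤ p → 4 ≤ n ∸ 1 → 1 ≤ k → r ≤ n ∸ 2 →
    p ≡ k * (n ∸ 1) + r →
    IsEx p (T1 n) (exA n p r ⊔ exB n p r)
    × (CaseA n r → IsEx p (T1 n) (exA n p r))
    × (¬ CaseA n r → IsEx p (T1 n) (exB n p r))
theorem2p1 p (suc n′) (suc k) r _ 4≤n′ _ r≤ refl with m≤n⇒∃[o]m+o≡n 4≤n′
... | l , refl = Extremal.extremal l k r (4 + l ∸ r) (m+[n∸m]≡n (≤-trans r≤ (n≤1+n (3 + l)))) (s≤s r≤)
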